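{- Let $l\ge 0$, let $d_l=\dim\mathcal{A}_l=\frac{(l+1)(l+2)}{2}$, and let $\mathscr{F}_l:\mathcal{A}_l\to\mathbb{Q}^{d_l}$ be the coordinate isomorphism given by the monomial basis. Let $D$ be the matrix of $\Delta_Q:\mathcal{A}_l\to\mathcal{A}_{l-2}$ in the monomial bases. Let $A$ (respectively $A_+$, $A_-$) be the $d_l\times d_l$ matrix of $\mathrm{Ave}_l$ (respectively $\mathrm{Ave}_{l,+}$, $\mathrm{Ave}_{l,- }$) in the monomial basis of $\mathcal{A}_l$. (i) Let $B$ be the matrix formed by columns of $A$ that form a basis of the column space of $A$, and let $\mathbf{v}_1,\dots,\mathbf{v}_t$ be a basis of the solution space $\{z : DBz=0\}$. Then $\mathscr{F}_l^{ -1}(B\mathbf{v}_1),\dots,\mathscr{F}_l^{ -1}(B\mathbf{v}_t)$ is a basis of $\mathcal{H}_l^\Gamma$. (ii) For each sign $\pm$, let $B_\pm$ be the matrix formed by columns of $A_\pm$ that form a basis of the column space of $A_\pm$, and let $\mathbf{v}_1^\pm,\dots,\mathbf{v}_{t_\pm}^\pm$ be a basis of $\{z : DB_\pm z=0\}$. Then $\mathscr{F}_l^{ -1}(B_\pm\mathbf{v}_1^\pm),\dots,\mathscr{F}_l^{ -1}(B_\pm\mathbf{v}_{t_\pm}^\pm)$ is a basis of $\mathcal{H}_{l,\pm}^\Gamma$.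
   Context: Let $D_{\mathrm{alg}}=\mathbb{Q}+\mathbb{Q}i+\mathbb{Q}j+\mathbb{Q}ij$ be the quaternion algebra over $\mathbb{Q}$ with $i^2=j^2=-1$, $ij=-ji$, with involution $\iota(a_0+a_1i+a_2j+a_3ij)=a_0-a_1i-a_2j-a_3ij$, $\mathrm{Tr}(x)=x+\iota(x)$, $\mathrm{Nm}(x)=x\,\iota(x)$. Let $\mathcal{O}=\mathbb{Z}+\mathbb{Z}i+\mathbb{Z}j+\mathbb{Z}w$ with $w=(1+i+j+ij)/2$ (the Hurwitz maximal order). Let $V=\{x\in D_{\mathrm{alg}}\mid \mathrm{Tr}(x)=0\}$, with basis $\mathbf{b}_1=-i+j+ij$, $\mathbf{b}_2=i-j+ij$, $\mathbf{b}_3=i+j-ij$; identify $x_1\mathbf{b}_1+x_2\mathbf{b}_2+x_3\mathbf{b}_3\in V$ with the row vector $x=(x_1,x_2,x_3)$. For $g\in D_{\mathrm{alg}}^\times$ let $\mathcal{F}(g)\in\mathrm{SL}_3(\mathbb{Q})$ be the matrix such that the map $x\mapsto g^{ -1}xg$ on $V$ is $x\mapsto x\,\mathcal{F}(g)$ on row vectors. Put $\Gamma=\mathcal{F}(\mathcal{O}^\times)$, a finite group of order $12$, and $\gamma_2=\mathcal{F}(i-j)$. Let $\mathcal{A}_l$ be the $\mathbb{Q}$-space of homogeneous polynomials of degree $l$ in $\mathbb{Q}[x_1,x_2,x_3]$ (including $0$; $\mathcal{A}_l=0$ for $l<0$), with monomial basis $x_1^{l_1}x_2^{l_2}x_3^{l_3}$,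 $l_1+l_2+l_3=l$, in some fixed order. Let $\Delta_Q=\frac12\left(\frac{\partial^2}{\partial x_1^2}+\frac{\partial^2}{\partial x_2^2}+\frac{\partial^2}{\partial x_3^2}+\frac{\partial^2}{\partial x_1\partial x_2}+\frac{\partial^2}{\partial x_2\partial x_3}+\frac{\partial^2}{\partial x_3\partial x_1}\right)$, $\mathcal{H}_l=\{f\in\mathcal{A}_l\mid\Delta_Qf=0\}$, and $\mathcal{H}_l^\Gamma=\{f\in\mathcal{H}_l\mid f(x\gamma)=f(x)\ \forall\gamma\in\Gamma\}$. Let $\mathfrak{T}_2=\{\mathcal{F}(y)\mid y\in\mathcal{O},\ \mathrm{Nm}(y)=2\}$ (which equals $\Gamma\gamma_2=\gamma_2\Gamma$) and define $T_2$ on $\mathcal{H}_l^\Gamma$ by $(T_2f)(x)=\sum_{\gamma\in\Gamma\backslash\mathfrak{T}_2}f(x\gamma^{ -1})$. Set $\mathcal{H}_{l,\pm}^\Gamma=\{f\in\mathcal{H}_l^\Gamma\mid T_2f=\pm(-1)^lf\}$. For $\gamma\in\mathrm{GL}_3(\mathbb{Q})$ put $(\gamma\cdot f)(x)=f(x\gamma)$, and define linear maps $\mathcal{A}_l\to\mathcal{A}_l$ by $\mathrm{Ave}_l(f)=\sum_{\gamma\in\Gamma}\gamma\cdot f$ and $\mathrm{Ave}_{l,\pm}(f)=\sum_{\gamma\in\Gamma}\gamma\cdot f\pm(-1)^l\sum_{\gamma\in\Gamma\gamma_2}\gamma\cdot f$ (double signs in the same order). Vectors in $\mathbb{Q}^n$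 are column vectors. -}

module Defs where

open import Algebra.Module.Bundles.Raw using (RawLeftModule)
open import Axiom.UniquenessOfIdentityProofs using (module Decidable⇒UIP)
open import Data.Bool.Base using (if_then_else_)
open import Data.Empty using (⊥-elim)
open import Data.Fin.Base using (Fin; zero; suc; toℕ; fromℕ<)
open import Data.Fin.Properties using (+↔⊎; toℕ<n; toℕ-fromℕ<; fromℕ<-toℕ; toℕ-injective)
open import Data.Integer.Base as ℤ using (ℤ; +_; -[1+_])
import Data.Integer.Properties as ℤ
import Data.Integer.Solver as ℤ-Solver
open import Data.List.Base as List using (List; []; _∷_; _++_; map; concatMap; cartesianProductWith)
open import Data.List.Membership.Propositional using (_∈_)
open import Data.List.Membership.Propositional.Properties using (∈-map⁺; ∈-map⁻)
open import Data.List.Relation.Unary.All as All using (All; []; _∷_; all?)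
open import Data.List.Relation.Unary.AllPairs using ([]; _∷_)
open import Data.List.Relation.Unary.Any using (here; there)
open import Data.List.Relation.Unary.Unique.Propositional using (Unique)
open import Data.Nat.Base as ℕ using (ℕ; zero; suc; s≤s; s≤s⁻¹; z≤n)
open import Data.Nat.DivMod using (m*n/n≡m)
import Data.Nat.Properties as ℕ
import Data.Nat.Solver as ℕ-Solver
open import Data.Product.Base using (Σ; Σ-syntax; ∃; ∃-syntax; _×_; _,_; proj₁; proj₂)
open import Data.Rational.Base using (ℚ; 0ℚ; 1ℚ; ½; ↥_; _+_; _*_; -_; _-_; 1/_; toℚᵘ; ≢-nonZero; +-0-rawMonoid)
open import Data.Rational.Literals using (fromℤ)
import Data.Rational.Properties as ℚ
open import Data.Rational.Solver using (module +-*-Solver)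
import Data.Rational.Unnormalised.Base as ℚᵘ
import Data.Rational.Unnormalised.Properties as ℚᵘ
open import Data.Sign.Base as Sign using (Sign)
open import Data.Sum.Base using (_⊎_; inj₁; inj₂)
open import Data.Sum.Function.Propositional using (_⊎-↔_)
open import Data.Vec.Base as Vec using (Vec; []; _∷_; lookup; tabulate; _[_]%=_; zipWith; replicate)
import Data.Vec.Properties as Vec
open import Data.Vec.Functional using (Vector; transpose)
open import Function.Base using (_∘_; id)
open import Function.Bundles using (_↔_; mk↔ₛ′)
open import Function.Construct.Composition using (_↔-∘_)
open import Function.Construct.Identity using (↔-id)
open import Function.Construct.Symmetry using (↔-sym)
open import Level using (0ℓ)
open import Relation.Binary.Definitions using (DecidableEquality)
open import Relation.Binary.PropositionalEquality
open import Relation.Nullary.Decidable using (Dec; yes; no; does; from-yes; _→-dec_)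

import Algebra.Definitions.RawMonoid +-0-rawMonoid as ℚ-Sum
import Data.List.Membership.DecPropositional as DecMembership
import Data.List.Relation.Unary.Unique.DecPropositional as DecUnique

-- Total reciprocal: the value at 0 is junk.
recip : ℚ → ℚ
recip p with p ℚ.≟ 0ℚ
... | yes _   = 0ℚ
... | no p≢0 = 1/_ p {{≢-nonZero p≢0}}

record Quaternion : Set where
  constructor quat
  field
    q₀ q₁ q₂ q₃ : ℚ

open Quaternion public

infixl 6 _⊕_
infixl 7 _⊛_
infixr 7 _⊙_

_⊕_ : Quaternion → Quaternion → Quaternion
quat a₀ a₁ a₂ a₃ ⊕ quat b₀ b₁ b₂ b₃ = quat (a₀ + b₀) (a₁ + b₁) (a₂ + b₂) (a₃ + b₃)

_⊙_ : ℚ → Quaternion → Quaternion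
c ⊙ quat a₀ a₁ a₂ a₃ = quat (c * a₀) (c * a₁) (c * a₂) (c * a₃)

_⊛_ : Quaternion → Quaternion → Quaternion
quat a₀ a₁ a₂ a₃ ⊛ quat b₀ b₁ b₂ b₃ = quat
  (a₀ * b₀ - a₁ * b₁ - a₂ * b₂ - a₃ * b₃)
  (a₀ * b₁ + a₁ * b₀ + a₂ * b₃ - a₃ * b₂)
  (a₀ * b₂ - a₁ * b₃ + a₂ * b₀ + a₃ * b₁)
  (a₀ * b₃ + a₁ * b₂ - a₂ * b₁ + a₃ * b₀)

𝟏 𝐢 𝐣 𝐢𝐣 𝐰 : Quaternion
𝟏  = quat 1ℚ 0ℚ 0ℚ 0ℚ
𝐢  = quat 0ℚ 1ℚ 0ℚ 0ℚ
𝐣  = quat 0ℚ 0ℚ 1ℚ 0ℚ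
𝐢𝐣 = 𝐢 ⊛ 𝐣
𝐰  = ½ ⊙ (𝟏 ⊕ 𝐢 ⊕ 𝐣 ⊕ 𝐢𝐣)

ι : Quaternion → Quaternion
ι (quat a₀ a₁ a₂ a₃) = quat a₀ (- a₁) (- a₂) (- a₃)

-- x + ι x and x ι x are rational (see Tr-rational and Nm-rational), so
-- trace and norm are read off from the coefficient of 1.
Tr Nm : Quaternion → ℚ
Tr x = q₀ (x ⊕ ι x)
Nm x = q₀ (x ⊛ ι x)

-- Inverse of a non-zero quaternion.
_⁻¹ : Quaternion → Quaternion
x ⁻¹ = recip (Nm x) ⊙ ι x

hurwitz : ℤ → ℤ → ℤ → ℤ → Quaternion
hurwitz a b c d = fromℤ a ⊙ 𝟏 ⊕ fromℤ b ⊙ 𝐢 ⊕ fromℤ c ⊙ 𝐣 ⊕ fromℤ d ⊙ 𝐰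

𝓞 : Quaternion → Set
𝓞 x = ∃[ a ] ∃[ b ] ∃[ c ] ∃[ d ] x ≡ hurwitz a b c d

𝓞ˣ : Quaternion → Set
𝓞ˣ u = 𝓞 u × ∃[ v ] 𝓞 v × u ⊛ v ≡ 𝟏 × v ⊛ u ≡ 𝟏

-- Vectors of vectors rather than functions, so that propositional
-- equality of matrices is equality of entries.
Mat₃ : Set
Mat₃ = Vec (Vec ℚ 3) 3

infixl 7 _⊗_ _ᵥ⊗_

entry : Mat₃ → Fin 3 → Fin 3 → ℚ
entry M i j = lookup (lookup M i) j

_ᵥ⊗_ : Vec ℚ 3 → Mat₃ → Vec ℚ 3
x ᵥ⊗ M = tabulate λ j → ℚ-Sum.sum λ i → lookup x i * entry M i j

_⊗_ : Mat₃ → Mat₃ → Mat₃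
M ⊗ N = Vec.map (_ᵥ⊗ N) M

det : Mat₃ → ℚ
det ((a ∷ b ∷ c ∷ []) ∷ (d ∷ e ∷ f ∷ []) ∷ (g ∷ h ∷ k ∷ []) ∷ []) =
  a * (e * k - f * h) - b * (d * k - f * g) + c * (d * h - e * g)

adjugate : Mat₃ → Mat₃
adjugate ((a ∷ b ∷ c ∷ []) ∷ (d ∷ e ∷ f ∷ []) ∷ (g ∷ h ∷ k ∷ []) ∷ []) =
  (e * k - f * h ∷ c * h - b * k ∷ b * f - c * e ∷ []) ∷
  (f * g - d * k ∷ a * k - c * g ∷ c * d - a * f ∷ []) ∷
  (d * h - e * g ∷ b * g - a * h ∷ a * e - b * d ∷ []) ∷ []

-- Inverse of an invertible matrix.
inverse : Mat₃ → Mat₃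
inverse M = Vec.map (Vec.map (recip (det M) *_)) (adjugate M)

𝐛 : Fin 3 → Quaternion
𝐛 zero             = quat 0ℚ (- 1ℚ) 1ℚ 1ℚ
𝐛 (suc zero)       = quat 0ℚ 1ℚ (- 1ℚ) 1ℚ
𝐛 (suc (suc zero)) = quat 0ℚ 1ℚ 1ℚ (- 1ℚ)

fromCoords : Vec ℚ 3 → Quaternion
fromCoords (x₁ ∷ x₂ ∷ x₃ ∷ []) =
  x₁ ⊙ 𝐛 zero ⊕ x₂ ⊙ 𝐛 (suc zero) ⊕ x₃ ⊙ 𝐛 (suc (suc zero))

-- Coordinates with respect to 𝐛 of a trace-zero quaternion
-- (see fromCoords-coords).
coords : Quaternion → Vec ℚ 3
coords (quat _ p q r) = ½ * (q + r) ∷ ½ * (p + r) ∷ ½ * (p + q) ∷ []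

-- Row k holds the coordinates of g⁻¹ 𝐛ₖ g; see ℱ-spec.  Opaque only to
-- keep conversion checking from unfolding it.
opaque
  ℱ : Quaternion → Mat₃
  ℱ g = tabulate λ k → coords (g ⁻¹ ⊛ 𝐛 k ⊛ g)

𝐢-𝐣 : Quaternion
𝐢-𝐣 = 𝐢 ⊕ (- 1ℚ) ⊙ 𝐣

γ₂ : Mat₃
γ₂ = ℱ 𝐢-𝐣

Γ : Mat₃ → Set
Γ M = ∃[ u ] 𝓞ˣ u × M ≡ ℱ u

Γγ₂ : Mat₃ → Set
Γγ₂ M = ∃[ γ ] Γ γ × M ≡ γ ⊗ γ₂

𝔗₂ : Mat₃ → Set
𝔗₂ M = ∃[ y ] 𝓞 y × Nm y ≡ fromℤ (+ 2) × M ≡ ℱ y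

quat-cong : ∀ {a₀ a₁ a₂ a₃ b₀ b₁ b₂ b₃} → a₀ ≡ b₀ → a₁ ≡ b₁ → a₂ ≡ b₂ → a₃ ≡ b₃ →
            quat a₀ a₁ a₂ a₃ ≡ quat b₀ b₁ b₂ b₃
quat-cong refl refl refl refl = refl

Tr-rational : ∀ x → x ⊕ ι x ≡ Tr x ⊙ 𝟏
Tr-rational (quat a₀ a₁ a₂ a₃) = quat-cong
  (sym (ℚ.*-identityʳ _)) (zeros a₁) (zeros a₂) (zeros a₃)
  where
  zeros : ∀ a → a - a ≡ (a₀ + a₀) * 0ℚ
  zeros a = trans (ℚ.+-inverseʳ a) (sym (ℚ.*-zeroʳ (a₀ + a₀)))

Nm-rational : ∀ x → x ⊛ ι x ≡ Nm x ⊙ 𝟏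
Nm-rational x@(quat a₀ a₁ a₂ a₃) = quat-cong
  (sym (ℚ.*-identityʳ _))
  (trans (solve 4 (λ a₀ a₁ a₂ a₃ → a₀ :* (:- a₁) :+ a₁ :* a₀ :+ a₂ :* (:- a₃) :- a₃ :* (:- a₂) := con 0ℚ) refl a₀ a₁ a₂ a₃) z)
  (trans (solve 4 (λ a₀ a₁ a₂ a₃ → a₀ :* (:- a₂) :- a₁ :* (:- a₃) :+ a₂ :* a₀ :+ a₃ :* (:- a₁) := con 0ℚ) refl a₀ a₁ a₂ a₃) z)
  (trans (solve 4 (λ a₀ a₁ a₂ a₃ → a₀ :* (:- a₃) :+ a₁ :* (:- a₂) :- a₂ :* (:- a₁) :+ a₃ :* a₀ := con 0ℚ) refl a₀ a₁ a₂ a₃) z)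
  where
  open +-*-Solver
  z = sym (ℚ.*-zeroʳ (Nm x))

module _ where
  open +-*-Solver

  fromCoords-coords : ∀ x → Tr x ≡ 0ℚ → fromCoords (coords x) ≡ x
  fromCoords-coords (quat a p q r) tr = quat-cong
    (trans (solve 3 (λ p q r → con ½ :* (q :+ r) :* con 0ℚ :+ con ½ :* (p :+ r) :* con 0ℚ :+ con ½ :* (p :+ q) :* con 0ℚ := con 0ℚ) refl p q r) (sym a≡0))
    (solve 3 (λ p q r → con ½ :* (q :+ r) :* con (- 1ℚ) :+ con ½ :* (p :+ r) :* con 1ℚ :+ con ½ :* (p :+ q) :* con 1ℚ := p) refl p q r)
    (solve 3 (λ p q r → con ½ :* (q :+ r) :* con 1ℚ :+ con ½ :* (p :+ r) :* con (- 1ℚ) :+ con ½ :* (p :+ q) :* con 1ℚ := q) refl p q r)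
    (solve 3 (λ p q r → con ½ :* (q :+ r) :* con 1ℚ :+ con ½ :* (p :+ r) :* con 1ℚ :+ con ½ :* (p :+ q) :* con (- 1ℚ) := r) refl p q r)
    where
    a≡0 : a ≡ 0ℚ
    a≡0 = trans (solve 1 (λ a → a := con ½ :* (a :+ a)) refl a)
                (trans (cong (½ *_) tr) (ℚ.*-zeroʳ ½))

private
  module Poly-Quaternion {n : ℕ} where
    open +-*-Solver

    record ℍ : Set where
      constructor poly
      field p₀ p₁ p₂ p₃ : Polynomial n
    open ℍ public

    infixl 6 _⊞_
    infixl 7 _⊠_
    _⊞_ _⊠_ : ℍ → ℍ → ℍ
    poly a₀ a₁ a₂ a₃ ⊞ poly b₀ b₁ b₂ b₃ = poly (a₀ :+ b₀) (a₁ :+ b₁) (a₂ :+ b₂) (a₃ :+ b₃)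
    poly a₀ a₁ a₂ a₃ ⊠ poly b₀ b₁ b₂ b₃ = poly
      (a₀ :* b₀ :- a₁ :* b₁ :- a₂ :* b₂ :- a₃ :* b₃)
      (a₀ :* b₁ :+ a₁ :* b₀ :+ a₂ :* b₃ :- a₃ :* b₂)
      (a₀ :* b₂ :- a₁ :* b₃ :+ a₂ :* b₀ :+ a₃ :* b₁)
      (a₀ :* b₃ :+ a₁ :* b₂ :- a₂ :* b₁ :+ a₃ :* b₀)
    scale : Polynomial n → ℍ → ℍ
    scale c (poly a₀ a₁ a₂ a₃) = poly (c :* a₀) (c :* a₁) (c :* a₂) (c :* a₃)
    conj : ℍ → ℍ
    conj (poly a₀ a₁ a₂ a₃) = poly a₀ (:- a₁) (:- a₂) (:- a₃)
    const : Quaternion → ℍ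
    const (quat a₀ a₁ a₂ a₃) = poly (con a₀) (con a₁) (con a₂) (con a₃)
    comb : Vec (Polynomial n) 3 → ℍ
    comb (x₁ ∷ x₂ ∷ x₃ ∷ []) =
      scale x₁ (const (𝐛 zero)) ⊞ scale x₂ (const (𝐛 (suc zero))) ⊞ scale x₃ (const (𝐛 (suc (suc zero))))
    crd : ℍ → Vec (Polynomial n) 3
    crd (poly _ p q r) = (con ½ :* (q :+ r)) ∷ (con ½ :* (p :+ r)) ∷ (con ½ :* (p :+ q)) ∷ []
    dot : (Fin 3 → Polynomial n) → Polynomial n
    dot f = f zero :+ (f (suc zero) :+ (f (suc (suc zero)) :+ con 0ℚ))

    lhs rhs : Polynomial n → ℍ → Vec (Polynomial n) 3 → ℍ
    lhs s g x = scale s (conj g) ⊠ comb x ⊠ g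
    rhs s g x = comb (tabulate λ j → dot λ i → lookup x i :* lookup (crd (scale s (conj g) ⊠ const (𝐛 i) ⊠ g)) j)

-- On row vectors, x ↦ g⁻¹ x g is multiplication by ℱ g.
opaque
  unfolding ℱ

  ℱ-spec : ∀ g x → g ⁻¹ ⊛ fromCoords x ⊛ g ≡ fromCoords (x ᵥ⊗ ℱ g)
  ℱ-spec g@(quat g₀ g₁ g₂ g₃) (x₁ ∷ x₂ ∷ x₃ ∷ []) = quat-cong
    (solve 8 (λ s g₀ g₁ g₂ g₃ x₁ x₂ x₃ → p₀ (lhs s (poly g₀ g₁ g₂ g₃) (x₁ ∷ x₂ ∷ x₃ ∷ [])) := p₀ (rhs s (poly g₀ g₁ g₂ g₃) (x₁ ∷ x₂ ∷ x₃ ∷ []))) refl (recip (Nm g)) g₀ g₁ g₂ g₃ x₁ x₂ x₃)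
    (solve 8 (λ s g₀ g₁ g₂ g₃ x₁ x₂ x₃ → p₁ (lhs s (poly g₀ g₁ g₂ g₃) (x₁ ∷ x₂ ∷ x₃ ∷ [])) := p₁ (rhs s (poly g₀ g₁ g₂ g₃) (x₁ ∷ x₂ ∷ x₃ ∷ []))) refl (recip (Nm g)) g₀ g₁ g₂ g₃ x₁ x₂ x₃)
    (solve 8 (λ s g₀ g₁ g₂ g₃ x₁ x₂ x₃ → p₂ (lhs s (poly g₀ g₁ g₂ g₃) (x₁ ∷ x₂ ∷ x₃ ∷ [])) := p₂ (rhs s (poly g₀ g₁ g₂ g₃) (x₁ ∷ x₂ ∷ x₃ ∷ []))) refl (recip (Nm g)) g₀ g₁ g₂ g₃ x₁ x₂ x₃)
    (solve 8 (λ s g₀ g₁ g₂ g₃ x₁ x₂ x₃ → p₃ (lhs s (poly g₀ g₁ g₂ g₃) (x₁ ∷ x₂ ∷ x₃ ∷ [])) := p₃ (rhs s (poly g₀ g₁ g₂ g₃) (x₁ ∷ x₂ ∷ x₃ ∷ []))) refl (recip (Nm g)) g₀ g₁ g₂ g₃ x₁ x₂ x₃)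
    where
    open +-*-Solver
    open Poly-Quaternion

module _ where
  open +-*-Solver

  *-inverse : ∀ {p} → p ≢ 0ℚ → recip p * p ≡ 1ℚ
  *-inverse {p} p≢0 with p ℚ.≟ 0ℚ
  ... | yes p≡0 = ⊥-elim (p≢0 p≡0)
  ... | no  p≢0 = ℚ.*-inverseˡ p {{≢-nonZero p≢0}}

  opaque
    unfolding ℱ

    det-ℱ : ∀ g → Nm g ≢ 0ℚ → det (ℱ g) ≡ 1ℚ
    det-ℱ g@(quat g₀ g₁ g₂ g₃) Nm≢0 = trans
      (solve 5 (λ s g₀ g₁ g₂ g₃ →
          let h = poly g₀ g₁ g₂ g₃
              row k = crd (scale s (conj h) ⊠ const (𝐛 k) ⊠ h)
              e i j = lookup (row i) j
              n = s :* p₀ (h ⊠ conj h)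
          in e 0F 0F :* (e 1F 1F :* e 2F 2F :- e 1F 2F :* e 2F 1F)
             :- e 0F 1F :* (e 1F 0F :* e 2F 2F :- e 1F 2F :* e 2F 0F)
             :+ e 0F 2F :* (e 1F 0F :* e 2F 1F :- e 1F 1F :* e 2F 0F)
             := n :* (n :* n))
        refl (recip (Nm g)) g₀ g₁ g₂ g₃)
      (cong (λ n → n * (n * n)) (*-inverse Nm≢0))
      where
      open Poly-Quaternion
      0F 1F 2F : Fin 3
      0F = zero
      1F = suc zero
      2F = suc (suc zero)

record Enumeration (P : Mat₃ → Set) : Set where
  field
    elements : List Mat₃
    unique   : Unique elements
    sound    : ∀ {M} → M ∈ elements → P M
    complete : ∀ {M} → P M → M ∈ elements

record CosetRepresentatives (G P : Mat₃ → Set) : Set where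
  field
    elements : List Mat₃
    unique   : Unique elements
    sound    : ∀ {M} → M ∈ elements → P M
    complete : ∀ {M} → P M → ∃[ δ ] ∃[ γ ] G δ × γ ∈ elements × M ≡ δ ⊗ γ
    distinct : ∀ {γ γ′ δ} → γ ∈ elements → γ′ ∈ elements → G δ → γ′ ≡ δ ⊗ γ → γ′ ≡ γ

private
  _≟_ : DecidableEquality Mat₃
  _≟_ = Vec.≡-dec (Vec.≡-dec ℚ._≟_)

  open DecMembership _≟_ using (_∈?_)
  open DecUnique _≟_ using (unique?)

  normForm : ℤ → ℤ → ℤ → ℤ → ℤ
  normForm a b c d = a ℤ.* a ℤ.+ b ℤ.* b ℤ.+ c ℤ.* c ℤ.+ d ℤ.* d ℤ.+ d ℤ.* (a ℤ.+ b ℤ.+ c)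

  fromℤ-+ : ∀ m n → fromℤ (m ℤ.+ n) ≡ fromℤ m + fromℤ n
  fromℤ-+ m n = ℚ.toℚᵘ-injective (ℚᵘ.≃-trans
    (ℚᵘ.*≡* (cong (ℤ._* + 1) (sym (cong₂ ℤ._+_ (ℤ.*-identityʳ m) (ℤ.*-identityʳ n)))))
    (ℚᵘ.≃-sym (ℚ.toℚᵘ-homo-+ (fromℤ m) (fromℤ n))))

  fromℤ-* : ∀ m n → fromℤ (m ℤ.* n) ≡ fromℤ m * fromℤ n
  fromℤ-* m n = ℚ.toℚᵘ-injective (ℚᵘ.≃-trans
    (ℚᵘ.*≡* refl)
    (ℚᵘ.≃-sym (ℚ.toℚᵘ-homo-* (fromℤ m) (fromℤ n))))

  fromℤ-injective : ∀ {m n} → fromℤ m ≡ fromℤ n → m ≡ n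
  fromℤ-injective eq = cong ↥_ eq

  Nm-hurwitz : ∀ a b c d → Nm (hurwitz a b c d) ≡ fromℤ (normForm a b c d)
  Nm-hurwitz a b c d = trans
    (solve 4 (λ a b c d →
        let h = scale a (const 𝟏) ⊞ scale b (const 𝐢) ⊞ scale c (const 𝐣) ⊞ scale d (const 𝐰)
        in p₀ (h ⊠ conj h) := a :* a :+ b :* b :+ c :* c :+ d :* d :+ d :* (a :+ b :+ c))
      refl (fromℤ a) (fromℤ b) (fromℤ c) (fromℤ d))
    (sym (begin
      fromℤ (a² ℤ.+ b² ℤ.+ c² ℤ.+ d² ℤ.+ d ℤ.* (a ℤ.+ b ℤ.+ c))
        ≡⟨ fromℤ-+ (a² ℤ.+ b² ℤ.+ c² ℤ.+ d²) (d ℤ.* (a ℤ.+ b ℤ.+ c)) ⟩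
      fromℤ (a² ℤ.+ b² ℤ.+ c² ℤ.+ d²) + fromℤ (d ℤ.* (a ℤ.+ b ℤ.+ c))
        ≡⟨ cong₂ _+_
             (trans (fromℤ-+ (a² ℤ.+ b² ℤ.+ c²) d²) (cong₂ _+_
               (trans (fromℤ-+ (a² ℤ.+ b²) c²) (cong₂ _+_
                 (trans (fromℤ-+ a² b²) (cong₂ _+_ (fromℤ-* a a) (fromℤ-* b b)))
                 (fromℤ-* c c)))
               (fromℤ-* d d)))
             (trans (fromℤ-* d (a ℤ.+ b ℤ.+ c)) (cong (fromℤ d *_)
               (trans (fromℤ-+ (a ℤ.+ b) c) (cong (_+ fromℤ c) (fromℤ-+ a b))))) ⟩
      fromℤ a * fromℤ a + fromℤ b * fromℤ b + fromℤ c * fromℤ c + fromℤ d * fromℤ d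
        + fromℤ d * (fromℤ a + fromℤ b + fromℤ c) ∎))
    where
    a² = a ℤ.* a
    b² = b ℤ.* b
    c² = c ℤ.* c
    d² = d ℤ.* d
    open +-*-Solver
    open Poly-Quaternion
    open ≡-Reasoning

  Nm-⊛ : ∀ x y → Nm (x ⊛ y) ≡ Nm x * Nm y
  Nm-⊛ (quat a₀ a₁ a₂ a₃) (quat b₀ b₁ b₂ b₃) =
    solve 8 (λ a₀ a₁ a₂ a₃ b₀ b₁ b₂ b₃ →
        let a = poly a₀ a₁ a₂ a₃
            b = poly b₀ b₁ b₂ b₃
        in p₀ ((a ⊠ b) ⊠ conj (a ⊠ b)) := p₀ (a ⊠ conj a) :* p₀ (b ⊠ conj b))
      refl a₀ a₁ a₂ a₃ b₀ b₁ b₂ b₃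
    where
    open +-*-Solver
    open Poly-Quaternion

  sq : ℤ → ℕ
  sq x = ℤ.∣ x ∣ ℕ.* ℤ.∣ x ∣

  +sq : ∀ x → + sq x ≡ x ℤ.* x
  +sq (+ n)    = ℤ.pos-* n n
  +sq -[1+ n ] = refl

  four-squares : ∀ a b c d →
    let 2* = ℤ._*_ (+ 2) in
    + (sq (2* a ℤ.+ d) ℕ.+ sq (2* b ℤ.+ d) ℕ.+ sq (2* c ℤ.+ d) ℕ.+ sq d) ≡ + 4 ℤ.* normForm a b c d
  four-squares a b c d = trans
    (cong₂ ℤ._+_ (cong₂ ℤ._+_ (cong₂ ℤ._+_
      (+sq (+ 2 ℤ.* a ℤ.+ d)) (+sq (+ 2 ℤ.* b ℤ.+ d))) (+sq (+ 2 ℤ.* c ℤ.+ d))) (+sq d))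
    (solve 4 (λ a b c d →
        (con (+ 2) :* a :+ d) :* (con (+ 2) :* a :+ d) :+ (con (+ 2) :* b :+ d) :* (con (+ 2) :* b :+ d)
          :+ (con (+ 2) :* c :+ d) :* (con (+ 2) :* c :+ d) :+ d :* d
        := con (+ 4) :* (a :* a :+ b :* b :+ c :* c :+ d :* d :+ d :* (a :+ b :+ c)))
      refl a b c d)
    where open ℤ-Solver.+-*-Solver

  normForm≥0 : ∀ a b c d → ∃[ n ] normForm a b c d ≡ + n
  normForm≥0 a b c d = nonNegative (normForm a b c d) (four-squares a b c d)
    where
    nonNegative : ∀ {m} x → + m ≡ + 4 ℤ.* x → ∃[ n ] x ≡ + n
    nonNegative (+ n)    _ = n , refl
    nonNegative -[1+ n ] ()

  box : List ℤ
  box = -[1+ 1 ] ∷ -[1+ 0 ] ∷ + 0 ∷ + 1 ∷ + 2 ∷ []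

  ∣∣≤2⇒∈box : ∀ x → ℤ.∣ x ∣ ℕ.≤ 2 → x ∈ box
  ∣∣≤2⇒∈box (+ 0) _ = there (there (here refl))
  ∣∣≤2⇒∈box (+ 1) _ = there (there (there (here refl)))
  ∣∣≤2⇒∈box (+ 2) _ = there (there (there (there (here refl))))
  ∣∣≤2⇒∈box (+ suc (suc (suc _))) (s≤s (s≤s ()))
  ∣∣≤2⇒∈box -[1+ 0 ] _ = there (here refl)
  ∣∣≤2⇒∈box -[1+ 1 ] _ = here refl
  ∣∣≤2⇒∈box -[1+ suc (suc _) ] (s≤s (s≤s ()))

  square≤8 : ∀ n → n ℕ.* n ℕ.≤ 8 → n ℕ.≤ 2
  square≤8 n n²≤8 = ℕ.≮⇒≥ λ 3≤n → ℕ.<⇒≱ (ℕ.*-mono-≤ 3≤n 3≤n) n²≤8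

  halve : ∀ x d → ℤ.∣ + 2 ℤ.* x ℤ.+ d ∣ ℕ.≤ 2 → ℤ.∣ d ∣ ℕ.≤ 2 → ℤ.∣ x ∣ ℕ.≤ 2
  halve x d p q = ℕ.*-cancelˡ-≤ 2 (begin
    2 ℕ.* ℤ.∣ x ∣                          ≡⟨ ℤ.abs-* (+ 2) x ⟨
    ℤ.∣ + 2 ℤ.* x ∣                        ≡⟨ cong ℤ.∣_∣ (solve 2 (λ x d → con (+ 2) :* x := con (+ 2) :* x :+ d :- d) refl x d) ⟩
    ℤ.∣ + 2 ℤ.* x ℤ.+ d ℤ.- d ∣            ≤⟨ ℤ.∣i-j∣≤∣i∣+∣j∣ (+ 2 ℤ.* x ℤ.+ d) d ⟩
    ℤ.∣ + 2 ℤ.* x ℤ.+ d ∣ ℕ.+ ℤ.∣ d ∣      ≤⟨ ℕ.+-mono-≤ p q ⟩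
    4                                      ∎)
    where
    open ℕ.≤-Reasoning
    open ℤ-Solver.+-*-Solver

  bounded : ∀ a b c d n → normForm a b c d ≡ + n → n ℕ.≤ 2 →
            a ∈ box × b ∈ box × c ∈ box × d ∈ box
  bounded a b c d n eq n≤2 =
      ∣∣≤2⇒∈box a (halve a d (small (+ 2 ℤ.* a ℤ.+ d) A≤) d≤2)
    , ∣∣≤2⇒∈box b (halve b d (small (+ 2 ℤ.* b ℤ.+ d) B≤) d≤2)
    , ∣∣≤2⇒∈box c (halve c d (small (+ 2 ℤ.* c ℤ.+ d) C≤) d≤2)
    , ∣∣≤2⇒∈box d d≤2
    where
    A = sq (+ 2 ℤ.* a ℤ.+ d)
    B = sq (+ 2 ℤ.* b ℤ.+ d)
    C = sq (+ 2 ℤ.* c ℤ.+ d)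
    total : A ℕ.+ B ℕ.+ C ℕ.+ sq d ≡ 4 ℕ.* n
    total = ℤ.+-injective (trans (four-squares a b c d) (trans (cong (+ 4 ℤ.*_) eq) (sym (ℤ.pos-* 4 n))))
    total≤8 : A ℕ.+ B ℕ.+ C ℕ.+ sq d ℕ.≤ 8
    total≤8 = subst (ℕ._≤ 8) (sym total) (ℕ.*-monoʳ-≤ 4 n≤2)
    ABC≤ : A ℕ.+ B ℕ.+ C ℕ.≤ 8
    ABC≤ = ℕ.≤-trans (ℕ.m≤m+n _ (sq d)) total≤8
    AB≤ : A ℕ.+ B ℕ.≤ 8
    AB≤ = ℕ.≤-trans (ℕ.m≤m+n _ C) ABC≤
    A≤ : A ℕ.≤ 8
    A≤ = ℕ.≤-trans (ℕ.m≤m+n _ B) AB≤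
    B≤ : B ℕ.≤ 8
    B≤ = ℕ.≤-trans (ℕ.m≤n+m _ A) AB≤
    C≤ : C ℕ.≤ 8
    C≤ = ℕ.≤-trans (ℕ.m≤n+m _ (A ℕ.+ B)) ABC≤
    small : ∀ x → sq x ℕ.≤ 8 → ℤ.∣ x ∣ ℕ.≤ 2
    small x = square≤8 ℤ.∣ x ∣
    d≤2 : ℤ.∣ d ∣ ℕ.≤ 2
    d≤2 = small d (ℕ.≤-trans (ℕ.m≤n+m _ (A ℕ.+ B ℕ.+ C)) total≤8)

  -- The units of the Hurwitz order up to sign.
  units : List (Σ Quaternion 𝓞ˣ)
  units =
    unit (+ 1) (+ 0) (+ 0) (+ 0)    (+ 1) (+ 0) (+ 0) (+ 0)       refl refl ∷
    unit (+ 0) (+ 1) (+ 0) (+ 0)    (+ 0) -[1+ 0 ] (+ 0) (+ 0)    refl refl ∷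
    unit (+ 0) (+ 0) (+ 1) (+ 0)    (+ 0) (+ 0) -[1+ 0 ] (+ 0)    refl refl ∷
    unit -[1+ 0 ] -[1+ 0 ] -[1+ 0 ] (+ 2)  (+ 1) (+ 1) (+ 1) -[1+ 1 ]  refl refl ∷
    unit (+ 0) (+ 0) (+ 0) (+ 1)    (+ 1) (+ 0) (+ 0) -[1+ 0 ]    refl refl ∷
    unit -[1+ 0 ] (+ 0) (+ 0) (+ 1)   (+ 0) (+ 0) (+ 0) -[1+ 0 ]   refl refl ∷
    unit (+ 0) -[1+ 0 ] (+ 0) (+ 1)   (+ 1) (+ 1) (+ 0) -[1+ 0 ]   refl refl ∷
    unit (+ 0) (+ 0) -[1+ 0 ] (+ 1)   (+ 1) (+ 0) (+ 1) -[1+ 0 ]   refl refl ∷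
    unit -[1+ 0 ] -[1+ 0 ] (+ 0) (+ 1)   (+ 0) (+ 1) (+ 0) -[1+ 0 ]   refl refl ∷
    unit -[1+ 0 ] (+ 0) -[1+ 0 ] (+ 1)   (+ 0) (+ 0) (+ 1) -[1+ 0 ]   refl refl ∷
    unit (+ 0) -[1+ 0 ] -[1+ 0 ] (+ 1)   (+ 1) (+ 1) (+ 1) -[1+ 0 ]   refl refl ∷
    unit -[1+ 0 ] -[1+ 0 ] -[1+ 0 ] (+ 1)   (+ 0) (+ 1) (+ 1) -[1+ 0 ]   refl refl ∷
    []
    where
    unit : ∀ a b c d a′ b′ c′ d′ → hurwitz a b c d ⊛ hurwitz a′ b′ c′ d′ ≡ 𝟏 →
           hurwitz a′ b′ c′ d′ ⊛ hurwitz a b c d ≡ 𝟏 → Σ Quaternion 𝓞ˣ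
    unit a b c d a′ b′ c′ d′ r l =
      hurwitz a b c d , (a , b , c , d , refl) , hurwitz a′ b′ c′ d′ , (a′ , b′ , c′ , d′ , refl) , r , l

  Exhaustive : ℤ → List Mat₃ → Set
  Exhaustive n xs =
    All (λ a → All (λ b → All (λ c → All (λ d →
      normForm a b c d ≡ n → ℱ (hurwitz a b c d) ∈ xs) box) box) box) box

  exhaustive? : ∀ n xs → Dec (Exhaustive n xs)
  exhaustive? n xs =
    all? (λ a → all? (λ b → all? (λ c → all? (λ d →
      (normForm a b c d ℤ.≟ n) →-dec (ℱ (hurwitz a b c d) ∈? xs)) box) box) box) box

  opaque
    Γ-elements : List Mat₃
    Γ-elements = map (ℱ ∘ proj₁) units

    Γ-sound : ∀ {M} → M ∈ Γ-elements → Γ M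
    Γ-sound M∈ with ∈-map⁻ (ℱ ∘ proj₁) {xs = units} M∈
    ... | (u , isUnit) , _ , eq = u , isUnit , eq

  opaque
    unfolding ℱ Γ-elements

    Γ-unique : Unique Γ-elements
    Γ-unique = from-yes (unique? Γ-elements)

    Γγ₂-unique : Unique (map (_⊗ γ₂) Γ-elements)
    Γγ₂-unique = from-yes (unique? (map (_⊗ γ₂) Γ-elements))

    norm-one : Exhaustive (+ 1) Γ-elements
    norm-one = from-yes (exhaustive? (+ 1) Γ-elements)

    norm-two : Exhaustive (+ 2) (map (_⊗ γ₂) Γ-elements)
    norm-two = from-yes (exhaustive? (+ 2) (map (_⊗ γ₂) Γ-elements))

  exhaust : ∀ n xs → n ℕ.≤ 2 → Exhaustive (+ n) xs →
            ∀ a b c d → normForm a b c d ≡ + n → ℱ (hurwitz a b c d) ∈ xs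
  exhaust n _ n≤2 ex a b c d eq =
    let a∈ , b∈ , c∈ , d∈ = bounded a b c d n eq n≤2
    in All.lookup (All.lookup (All.lookup (All.lookup ex a∈) b∈) c∈) d∈ eq

  Nm-unit : ∀ a b c d a′ b′ c′ d′ → hurwitz a b c d ⊛ hurwitz a′ b′ c′ d′ ≡ 𝟏 → normForm a b c d ≡ + 1
  Nm-unit a b c d a′ b′ c′ d′ eq =
    let m , m-eq = normForm≥0 a b c d
        n , n-eq = normForm≥0 a′ b′ c′ d′
        mn≡1 : m ℕ.* n ≡ 1
        mn≡1 = ℤ.+-injective (trans (ℤ.pos-* m n) (trans (cong₂ ℤ._*_ (sym m-eq) (sym n-eq)) product))
    in trans m-eq (cong +_ (ℕ.m*n≡1⇒m≡1 m n mn≡1))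
    where
    product : normForm a b c d ℤ.* normForm a′ b′ c′ d′ ≡ + 1
    product = fromℤ-injective (begin
      fromℤ (normForm a b c d ℤ.* normForm a′ b′ c′ d′)
        ≡⟨ fromℤ-* (normForm a b c d) (normForm a′ b′ c′ d′) ⟩
      fromℤ (normForm a b c d) * fromℤ (normForm a′ b′ c′ d′)
        ≡⟨ cong₂ _*_ (Nm-hurwitz a b c d) (Nm-hurwitz a′ b′ c′ d′) ⟨
      Nm (hurwitz a b c d) * Nm (hurwitz a′ b′ c′ d′)
        ≡⟨ Nm-⊛ (hurwitz a b c d) (hurwitz a′ b′ c′ d′) ⟨
      Nm (hurwitz a b c d ⊛ hurwitz a′ b′ c′ d′)
        ≡⟨ cong Nm eq ⟩
      fromℤ (+ 1) ∎)
      where open ≡-Reasoning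

Γ-enumeration : Enumeration Γ
Γ-enumeration = record
  { elements = Γ-elements
  ; unique   = Γ-unique
  ; sound    = Γ-sound
  ; complete = complete
  }
  where
  complete : ∀ {M} → Γ M → M ∈ Γ-elements
  complete (u , ((a , b , c , d , u≡) , v , (a′ , b′ , c′ , d′ , v≡) , uv≡1 , _) , M≡ℱu) =
    subst (_∈ Γ-elements) (sym (trans M≡ℱu (cong ℱ u≡)))
      (exhaust 1 Γ-elements (s≤s z≤n) norm-one a b c d
        (Nm-unit a b c d a′ b′ c′ d′ (trans (cong₂ _⊛_ (sym u≡) (sym v≡)) uv≡1)))

Γγ₂-enumeration : Enumeration Γγ₂
Γγ₂-enumeration = record
  { elements = map (_⊗ γ₂) Γ-elements
  ; unique   = Γγ₂-unique
  ; sound    = sound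
  ; complete = complete
  }
  where
  sound : ∀ {M} → M ∈ map (_⊗ γ₂) Γ-elements → Γγ₂ M
  sound M∈ with ∈-map⁻ (_⊗ γ₂) {xs = Γ-elements} M∈
  ... | γ , γ∈ , eq = γ , Γ-sound γ∈ , eq
  complete : ∀ {M} → Γγ₂ M → M ∈ map (_⊗ γ₂) Γ-elements
  complete (γ , Γγ , eq) =
    subst (_∈ map (_⊗ γ₂) Γ-elements) (sym eq) (∈-map⁺ (_⊗ γ₂) (Enumeration.complete Γ-enumeration Γγ))

Γ\𝔗₂ : CosetRepresentatives Γ 𝔗₂
Γ\𝔗₂ = record
  { elements = γ₂ ∷ []
  ; unique   = [] ∷ []
  ; sound    = sound
  ; complete = complete
  ; distinct = λ { (here γ≡γ₂) (here γ′≡γ₂) _ _ → trans γ′≡γ₂ (sym γ≡γ₂) }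
  }
  where
  sound : ∀ {M} → M ∈ γ₂ ∷ [] → 𝔗₂ M
  sound (here M≡γ₂) = 𝐢-𝐣 , 𝐢-𝐣∈𝓞 , Nm-𝐢-𝐣 , M≡γ₂
    where
    𝐢-𝐣∈𝓞 : 𝓞 𝐢-𝐣
    𝐢-𝐣∈𝓞 = + 0 , + 1 , -[1+ 0 ] , + 0 , refl
    Nm-𝐢-𝐣 : Nm 𝐢-𝐣 ≡ fromℤ (+ 2)
    Nm-𝐢-𝐣 = refl
  norm≡2 : ∀ a b c d y → y ≡ hurwitz a b c d → Nm y ≡ fromℤ (+ 2) → normForm a b c d ≡ + 2
  norm≡2 a b c d y y≡ Nm≡2 = fromℤ-injective {normForm a b c d} {+ 2} (begin
    fromℤ (normForm a b c d)  ≡⟨ Nm-hurwitz a b c d ⟨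
    Nm (hurwitz a b c d)      ≡⟨ cong Nm y≡ ⟨
    Nm y                      ≡⟨ Nm≡2 ⟩
    fromℤ (+ 2)               ∎)
    where open ≡-Reasoning
  complete : ∀ {M} → 𝔗₂ M → ∃[ δ ] ∃[ γ ] Γ δ × γ ∈ γ₂ ∷ [] × M ≡ δ ⊗ γ
  complete (y , (a , b , c , d , y≡) , Nm≡2 , M≡ℱy) =
    fromΓγ₂ (subst (_∈ map (_⊗ γ₂) Γ-elements) (sym (trans M≡ℱy (cong ℱ y≡)))
      (exhaust 2 (map (_⊗ γ₂) Γ-elements) (s≤s (s≤s z≤n)) norm-two a b c d
        (norm≡2 a b c d y y≡ Nm≡2)))
    where
    fromΓγ₂ : ∀ {M} → M ∈ map (_⊗ γ₂) Γ-elements → ∃[ δ ] ∃[ γ ] Γ δ × γ ∈ γ₂ ∷ [] × M ≡ δ ⊗ γ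
    fromΓγ₂ M∈ =
      let δ , Γδ , eq = Enumeration.sound Γγ₂-enumeration M∈
      in δ , γ₂ , Γδ , here refl , eq

opaque
  unfolding Γ-elements

  order-Γ : List.length (Enumeration.elements Γ-enumeration) ≡ 12
  order-Γ = refl

Exponent : Set
Exponent = Vec ℕ 3

degree : Exponent → ℕ
degree = Vec.sum

_≟ₑ_ : DecidableEquality Exponent
_≟ₑ_ = Vec.≡-dec ℕ._≟_

-- Formal sums of terms c xᵏ, possibly with repeated exponents; equality
-- of polynomials is equality of all coefficients.
Polynomial : Set
Polynomial = List (ℚ × Exponent)

coeff : Polynomial → Exponent → ℚ
coeff []            m = 0ℚ
coeff ((c , k) ∷ f) m = (if does (k ≟ₑ m) then c else 0ℚ) + coeff f m

infix 4 _≈_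
infixl 6 _+ₚ_
infixl 7 _*ₚ_
infixr 7 _·ₚ_
infixr 8 _^ₚ_

_≈_ : Polynomial → Polynomial → Set
f ≈ g = ∀ m → coeff f m ≡ coeff g m

0ₚ 1ₚ : Polynomial
0ₚ = []
1ₚ = (1ℚ , replicate 3 0) ∷ []

_+ₚ_ : Polynomial → Polynomial → Polynomial
_+ₚ_ = _++_

_·ₚ_ : ℚ → Polynomial → Polynomial
c ·ₚ f = map (λ (d , k) → c * d , k) f

-ₚ_ : Polynomial → Polynomial
-ₚ f = (- 1ℚ) ·ₚ f

_*ₚ_ : Polynomial → Polynomial → Polynomial
_*ₚ_ = cartesianProductWith λ (c , k) (d , m) → c * d , zipWith ℕ._+_ k m

_^ₚ_ : Polynomial → ℕ → Polynomial
f ^ₚ zero  = 1ₚ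
f ^ₚ suc n = f *ₚ f ^ₚ n

sumₚ : List Polynomial → Polynomial
sumₚ = List.foldr _+ₚ_ 0ₚ

x^_ : Exponent → Polynomial
x^ k = (1ℚ , k) ∷ []

polynomials : RawLeftModule ℚ 0ℓ 0ℓ
polynomials = record
  { Carrierᴹ = Polynomial
  ; _≈ᴹ_     = _≈_
  ; _+ᴹ_     = _+ₚ_
  ; _*ₗ_     = _·ₚ_
  ; 0ᴹ       = 0ₚ
  ; -ᴹ_      = -ₚ_
  }

∂ : Fin 3 → Polynomial → Polynomial
∂ i = map λ (c , k) → c * fromℤ (+ lookup k i) , k [ i ]%= ℕ.pred

Δ-Q : Polynomial → Polynomial
Δ-Q f = ½ ·ₚ (∂ x₁ (∂ x₁ f) +ₚ ∂ x₂ (∂ x₂ f) +ₚ ∂ x₃ (∂ x₃ f)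
           +ₚ ∂ x₁ (∂ x₂ f) +ₚ ∂ x₂ (∂ x₃ f) +ₚ ∂ x₃ (∂ x₁ f))
  where
  x₁ x₂ x₃ : Fin 3
  x₁ = zero
  x₂ = suc zero
  x₃ = suc (suc zero)

-- The j-th coordinate of the row vector x γ, as a linear form in x.
linearForm : Mat₃ → Fin 3 → Polynomial
linearForm γ j = List.tabulate λ i → entry γ i j , replicate 3 0 [ i ]%= suc

infixr 7 _∙_

-- (γ ∙ f)(x) = f (x γ)
_∙_ : Mat₃ → Polynomial → Polynomial
γ ∙ f = concatMap substitute f
  where
  substitute : ℚ × Exponent → Polynomial
  substitute (c , k₁ ∷ k₂ ∷ k₃ ∷ []) =
    c ·ₚ (linearForm γ zero ^ₚ k₁ *ₚ linearForm γ (suc zero) ^ₚ k₂ *ₚ linearForm γ (suc (suc zero)) ^ₚ k₃)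

Matrix : ℕ → ℕ → Set
Matrix m n = Vector (Vector ℚ n) m

infixr 7 _*ᵥ_
infixl 7 _*ₘ_

_*ᵥ_ : ∀ {m n} → Matrix m n → Vector ℚ n → Vector ℚ m
(A *ᵥ v) i = ℚ-Sum.sum λ j → A i j * v j

_*ₘ_ : ∀ {m n p} → Matrix m n → Matrix n p → Matrix m p
(A *ₘ B) i k = ℚ-Sum.sum λ j → A i j * B j k

ℚ^_ : ℕ → RawLeftModule ℚ 0ℓ 0ℓ
ℚ^ n = record
  { Carrierᴹ = Vector ℚ n
  ; _≈ᴹ_     = λ v w → ∀ i → v i ≡ w i
  ; _+ᴹ_     = λ v w i → v i + w i
  ; _*ₗ_     = λ c v i → c * v i
  ; 0ᴹ       = λ _ → 0ℚ
  ; -ᴹ_      = λ v i → - v i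
  }

module _ (V : RawLeftModule ℚ 0ℓ 0ℓ) where
  open RawLeftModule V
  open import Algebra.Definitions.RawMonoid +ᴹ-rawMonoid using (sum)

  linearCombination : ∀ {n} → Vector ℚ n → Vector Carrierᴹ n → Carrierᴹ
  linearCombination c vs = sum λ i → c i *ₗ vs i

  Span : ∀ {n} → Vector Carrierᴹ n → Carrierᴹ → Set
  Span vs v = ∃[ c ] v ≈ᴹ linearCombination c vs

  record IsBasis {n} (U : Carrierᴹ → Set) (vs : Vector Carrierᴹ n) : Set where
    field
      members     : ∀ i → U (vs i)
      independent : ∀ c → linearCombination c vs ≈ᴹ 0ᴹ → ∀ i → c i ≡ 0ℚ
      spanning    : ∀ v → U v → Span vs v

ColumnSpace : ∀ {m n} → Matrix m n → Vector ℚ m → Set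
ColumnSpace {m} A = Span (ℚ^ m) (transpose A)

SolutionSpace : ∀ {m n} → Matrix m n → Vector ℚ n → Set
SolutionSpace A z = ∀ i → (A *ᵥ z) i ≡ 0ℚ

selectColumns : ∀ {m n r} → Matrix m n → (Fin r → Fin n) → Matrix m r
selectColumns A s i j = A i (s j)

𝓐 : ℤ → Polynomial → Set
𝓐 l f = ∀ m → coeff f m ≢ 0ℚ → + degree m ≡ l

𝓗 : ℕ → Polynomial → Set
𝓗 l f = 𝓐 (+ l) f × Δ-Q f ≈ 0ₚ

𝓗^Γ : ℕ → Polynomial → Set
𝓗^Γ l f = 𝓗 l f × (∀ γ → Γ γ → γ ∙ f ≈ f)

-- On Γ-invariant polynomials the sum does not depend on the choice of
-- representatives.
T₂ : Polynomial → Polynomial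
T₂ f = sumₚ (map (λ γ → inverse γ ∙ f) (CosetRepresentatives.elements Γ\𝔗₂))

[-1]^_ : ℕ → ℚ
[-1]^ zero  = 1ℚ
[-1]^ suc l = - ([-1]^ l)

-- ±(-1)ˡ
signed : Sign → ℕ → ℚ
signed Sign.+ l = [-1]^ l
signed Sign.- l = - ([-1]^ l)

𝓗^Γ± : Sign → ℕ → Polynomial → Set
𝓗^Γ± σ l f = 𝓗^Γ l f × T₂ f ≈ signed σ l ·ₚ f

Ave : Polynomial → Polynomial
Ave f = sumₚ (map (_∙ f) (Enumeration.elements Γ-enumeration))

Ave± : Sign → ℕ → Polynomial → Polynomial
Ave± σ l f = Ave f +ₚ signed σ l ·ₚ sumₚ (map (_∙ f) (Enumeration.elements Γγ₂-enumeration))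

dim : ℤ → ℕ
dim (+ l)    = (l ℕ.+ 1) ℕ.* (l ℕ.+ 2) ℕ./ 2
dim -[1+ _ ] = 0

Monomial : ℤ → Set
Monomial l = Σ[ k ∈ Exponent ] + degree k ≡ l

MonomialOrder : ℤ → Set
MonomialOrder l = Fin (dim l) ↔ Monomial l

module _ {l : ℤ} (order : MonomialOrder l) where
  open import Function.Bundles using (Inverse)

  exponent : Fin (dim l) → Exponent
  exponent i = proj₁ (Inverse.to order i)

  𝓕 : Polynomial → Vector ℚ (dim l)
  𝓕 f i = coeff f (exponent i)

  𝓕⁻¹ : Vector ℚ (dim l) → Polynomial
  𝓕⁻¹ v = linearCombination polynomials v (λ i → x^ exponent i)

-- Meaningful for T restricting to a linear map 𝓐 l → 𝓐 l′.
matrix : ∀ {l l′} → MonomialOrder l → MonomialOrder l′ → (Polynomial → Polynomial) → Matrix (dim l′) (dim l)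
matrix order order′ T i j = 𝓕 order′ (T (x^ exponent order j)) i

-- Orders exist, and dim l is the number of monomials of degree l.
someOrder : ∀ l → MonomialOrder l
someOrder -[1+ _ ] = mk↔ₛ′ (λ ()) (λ ()) (λ ()) (λ ())
someOrder (+ l)    = subst (λ n → Fin n ↔ Monomial (+ l)) (count l) (enumerate l)
  where
  T : ℕ → ℕ
  T zero    = 1
  T (suc l) = T l ℕ.+ (2 ℕ.+ l)

  twice : ∀ l → T l ℕ.* 2 ≡ (l ℕ.+ 1) ℕ.* (l ℕ.+ 2)
  twice zero    = refl
  twice (suc l) = trans (ℕ.*-distribʳ-+ 2 (T l) (2 ℕ.+ l))
    (trans (cong (ℕ._+ (2 ℕ.+ l) ℕ.* 2) (twice l))
      (solve 1 (λ l → (l :+ con 1) :* (l :+ con 2) :+ (con 2 :+ l) :* con 2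
                   := (con 1 :+ l :+ con 1) :* (con 1 :+ l :+ con 2)) refl l))
    where open ℕ-Solver.+-*-Solver

  count : ∀ l → T l ≡ dim (+ l)
  count l = trans (sym (m*n/n≡m (T l) 2)) (cong (ℕ._/ 2) (twice l))

  monomial-≡ : ∀ {l} {p q : Monomial l} → proj₁ p ≡ proj₁ q → p ≡ q
  monomial-≡ {p = k , p} {.k , q} refl = cong (k ,_) (Decidable⇒UIP.≡-irrelevant ℤ._≟_ p q)

  base : Fin 1 ↔ Monomial (+ 0)
  base = mk↔ₛ′ (λ _ → replicate 3 0 , refl) (λ _ → zero)
    (λ { (0 ∷ 0 ∷ 0 ∷ [] , refl) → refl }) (λ { zero → refl })

  step : ∀ l → (Monomial (+ l) ⊎ Fin (2 ℕ.+ l)) ↔ Monomial (+ suc l)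
  step l = mk↔ₛ′ to from to∘from from∘to
    where
    to : Monomial (+ l) ⊎ Fin (2 ℕ.+ l) → Monomial (+ suc l)
    to (inj₁ (a ∷ k , eq)) = suc a ∷ k , cong ℤ.suc eq
    to (inj₂ i) = 0 ∷ toℕ i ∷ suc l ℕ.∸ toℕ i ∷ [] , cong +_ (trans
      (cong (toℕ i ℕ.+_) (ℕ.+-identityʳ _)) (ℕ.m+[n∸m]≡n (s≤s⁻¹ (toℕ<n i))))

    b≤ : ∀ b c → b ℕ.+ (c ℕ.+ 0) ≡ suc l → b ℕ.< 2 ℕ.+ l
    b≤ b c eq = s≤s (subst (b ℕ.≤_) eq (ℕ.m≤m+n b _))

    from : Monomial (+ suc l) → Monomial (+ l) ⊎ Fin (2 ℕ.+ l)
    from (suc a ∷ k , eq)          = inj₁ (a ∷ k , cong ℤ.pred eq)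
    from (zero ∷ b ∷ c ∷ [] , eq) = inj₂ (fromℕ< (b≤ b c (ℤ.+-injective eq)))

    to∘from : ∀ k → to (from k) ≡ k
    to∘from (suc a ∷ k , eq)          = monomial-≡ refl
    to∘from (zero ∷ b ∷ c ∷ [] , eq) = monomial-≡ (cong (0 ∷_) (cong₂ (λ b c → b ∷ c ∷ [])
      (toℕ-fromℕ< b<)
      (trans (cong₂ ℕ._∸_ (sym (ℤ.+-injective eq)) (toℕ-fromℕ< b<))
        (trans (ℕ.m+n∸m≡n b (c ℕ.+ 0)) (ℕ.+-identityʳ c)))))
      where b< = b≤ b c (ℤ.+-injective eq)

    from∘to : ∀ x → from (to x) ≡ x
    from∘to (inj₁ (a ∷ k , eq)) = cong inj₁ (monomial-≡ refl)
    from∘to (inj₂ i) = cong inj₂ (fromℕ<-toℕ i _)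

  enumerate : ∀ l → Fin (T l) ↔ Monomial (+ l)
  enumerate zero    = base
  enumerate (suc l) = step l ↔-∘ ((enumerate l ⊎-↔ ↔-id _) ↔-∘ +↔⊎)

{-# OPTIONS --safe #-}
module Submission where

-- The averaging operator P (Ave or Ave±) maps 𝓐 l onto the invariants (or the
-- T₂-eigenspace), on which it acts as the scalar 12 (or 24).  Hence the chosen columns
-- B of its matrix form a basis of this subspace, z ↦ 𝓕⁻¹ (B z) is an isomorphism onto
-- it, and the kernel of Δ-Q in it corresponds to the solutions of D B z = 0.  That
-- P f lies in the subspace follows from (γ γ′) ∙ f = γ ∙ (γ′ ∙ f) and from Γ ∪ Γγ₂
-- being a group of which Γ is a subgroup of index 2.
--
-- A polynomial is a list of terms, so it is studied through the linear functionals
-- Σ c xᵏ ↦ Σ c φ(k): two polynomials are equal when all of them agree.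

open import Algebra.Bundles using (CommutativeMonoid; CommutativeRing)
open import Axiom.UniquenessOfIdentityProofs using (module Decidable⇒UIP)
open import Data.Bool.Base using (if_then_else_)
open import Data.Fin.Base using (Fin; zero; suc)
open import Data.Fin.Patterns using (0F; 1F; 2F)
open import Data.Fin.Properties using (suc-injective)
open import Data.Integer.Base as ℤ using (ℤ; +_; _-_)
import Data.Integer.Properties as ℤ
open import Data.List.Base using (List; []; _∷_; _++_; map; length; deduplicate)
open import Data.List.Membership.Propositional using (_∈_)
open import Data.List.Membership.Propositional.Properties using (∈-++⁺ˡ; ∈-++⁺ʳ; ∈-deduplicate⁺)
open import Data.List.Membership.Propositional.Properties.WithK using (unique∧set⇒bag)
open import Data.List.Relation.Binary.BagAndSetEquality using (∼bag⇒↭)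
open import Data.List.Relation.Binary.Permutation.Propositional as ↭ using (_↭_)
open import Data.List.Relation.Unary.All as All using (All; []; _∷_; all?)
open import Data.List.Relation.Unary.AllPairs using ([]; _∷_)
open import Data.List.Relation.Unary.Any using (here; there)
open import Data.List.Relation.Unary.Unique.Propositional using (Unique)
open import Data.Nat.Base as ℕ using (ℕ; zero; suc)
import Data.Nat.Properties as ℕ
import Data.Nat.Solver as ℕ-Solver
open import Data.Product.Base using (_×_; _,_; proj₁; proj₂; ∃-syntax)
open import Data.Rational.Base using (ℚ; 0ℚ; 1ℚ; ½; _+_; _*_; -_; _/_; +-0-rawMonoid)
open import Data.Rational.Literals using (fromℤ)
import Data.Rational.Properties as ℚ
open import Data.Rational.Solver using (module +-*-Solver)
open import Data.Sign.Base as Sign using (Sign)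
open import Data.Vec.Base as Vec using (Vec; []; _∷_; lookup; zipWith; replicate; _[_]%=_)
open import Data.Vec.Functional using (Vector; transpose)
import Data.Vec.Properties as Vec
open import Function.Base using (_∘_)
open import Function.Bundles using (Inverse; mk⇔)
open import Level using (0ℓ)
open import Relation.Binary.Definitions using (DecidableEquality)
open import Relation.Binary.PropositionalEquality
open import Relation.Nullary.Decidable using (Dec; does; yes; no; from-yes; _×-dec_)
open import Relation.Nullary.Negation using (contradiction)

open import Algebra.Definitions.RawMonoid +-0-rawMonoid using () renaming (_×_ to _×ℚ_)
open import Algebra.Properties.CommutativeSemigroup
  (CommutativeMonoid.commutativeSemigroup ℚ.+-0-commutativeMonoid) using () renaming (interchange to +-interchange)
open import Algebra.Properties.Semiring.Sum (CommutativeRing.semiring ℚ.+-*-commutativeRing)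
  using (sum; sum-cong-≗; ∑-comm; *-distribˡ-sum; *-distribʳ-sum)
import Data.List.Membership.DecPropositional as DecMembership
import Data.List.Relation.Unary.Unique.DecPropositional as DecUnique
import Data.List.Relation.Unary.Unique.DecPropositional.Properties as DecUniqueₚ

open import Defs

open ≡-Reasoning

-- Linear functionals on polynomials

-- Coefficients alone do not carry through substitution: a coefficient of a product is a
-- convolution, and one of `γ ∙ f` mixes many monomials of `f`. The functionals `eval φ` for all `φ`
-- form a closed class: an operator defined term by term turns `eval φ` into another functional, a
-- product turns it into an iterated one. Well-definedness, linearity and the ring laws thus become
-- identities between finite sums. The scalar 12 is the order of Γ, and 24 is twice that. The sign
-- condition fits because `T₂` turns out to be the action of the single involution `γ₂`, and ±(-1)ˡ
-- squares to one: averaging against this sign projects, up to a factor, onto one eigenspace. The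
-- facts needed about Γ are checked by evaluation on its twelve matrices.

eval : (Exponent → ℚ) → Polynomial → ℚ
eval φ []            = 0ℚ
eval φ ((c , k) ∷ f) = c * φ k + eval φ f

eval-+ₚ : ∀ φ f g → eval φ (f +ₚ g) ≡ eval φ f + eval φ g
eval-+ₚ φ []            g = sym (ℚ.+-identityˡ _)
eval-+ₚ φ ((c , k) ∷ f) g =
  trans (cong (λ x → c * φ k + x) (eval-+ₚ φ f g)) (sym (ℚ.+-assoc (c * φ k) (eval φ f) (eval φ g)))

eval-·ₚ : ∀ φ c f → eval φ (c ·ₚ f) ≡ c * eval φ f
eval-·ₚ φ c []            = sym (ℚ.*-zeroʳ c)
eval-·ₚ φ c ((d , k) ∷ f) = begin
  c * d * φ k + eval φ (c ·ₚ f)   ≡⟨ cong₂ _+_ (ℚ.*-assoc c d (φ k)) (eval-·ₚ φ c f) ⟩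
  c * (d * φ k) + c * eval φ f    ≡⟨ ℚ.*-distribˡ-+ c (d * φ k) (eval φ f) ⟨
  c * (d * φ k + eval φ f)        ∎

eval-x^ : ∀ φ k → eval φ (x^ k) ≡ φ k
eval-x^ φ k = trans (ℚ.+-identityʳ _) (ℚ.*-identityˡ _)

eval-cong : ∀ {φ ψ} → (∀ k → φ k ≡ ψ k) → ∀ f → eval φ f ≡ eval ψ f
eval-cong φ≗ψ []            = refl
eval-cong φ≗ψ ((c , k) ∷ f) = cong₂ _+_ (cong (c *_) (φ≗ψ k)) (eval-cong φ≗ψ f)

eval-0 : ∀ f → eval (λ _ → 0ℚ) f ≡ 0ℚ
eval-0 []            = refl
eval-0 ((c , k) ∷ f) = cong₂ _+_ (ℚ.*-zeroʳ c) (eval-0 f)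

eval-+ : ∀ φ ψ f → eval (λ k → φ k + ψ k) f ≡ eval φ f + eval ψ f
eval-+ φ ψ []            = refl
eval-+ φ ψ ((c , k) ∷ f) =
  trans (cong₂ _+_ (ℚ.*-distribˡ-+ c (φ k) (ψ k)) (eval-+ φ ψ f))
        (+-interchange (c * φ k) (c * ψ k) (eval φ f) (eval ψ f))

eval-* : ∀ c φ f → eval (λ k → c * φ k) f ≡ c * eval φ f
eval-* c φ []            = sym (ℚ.*-zeroʳ c)
eval-* c φ ((d , k) ∷ f) =
  trans (cong (λ x → d * (c * φ k) + x) (eval-* c φ f))
        (solve 4 (λ c d x y → d :* (c :* x) :+ c :* y := c :* (d :* x :+ y)) refl c d (φ k) (eval φ f))
  where open +-*-Solver

-- Fubini for two finite formal sums. Both the commutativity of the product and the multiplicativity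
-- of substitution rest on it.
eval-swap : ∀ (φ : Exponent → Exponent → ℚ) f g →
            eval (λ k → eval (φ k) g) f ≡ eval (λ m → eval (λ k → φ k m) f) g
eval-swap φ []            g = sym (eval-0 g)
eval-swap φ ((c , k) ∷ f) g = begin
  c * eval (φ k) g + eval (λ k → eval (φ k) g) f
    ≡⟨ cong₂ _+_ (eval-* c (φ k) g) (sym (eval-swap φ f g)) ⟨
  eval (λ m → c * φ k m) g + eval (λ m → eval (λ k → φ k m) f) g
    ≡⟨ eval-+ (λ m → c * φ k m) (λ m → eval (λ k → φ k m) f) g ⟨
  eval (λ m → c * φ k m + eval (λ k → φ k m) f) g ∎

δ : Exponent → Exponent → ℚ
δ m k = if does (k ≟ₑ m) then 1ℚ else 0ℚ

δ-refl : ∀ m → δ m m ≡ 1ℚ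
δ-refl m with m ≟ₑ m
... | yes _   = refl
... | no  m≢m = contradiction refl m≢m

δ-≢ : ∀ {m k} → k ≢ m → δ m k ≡ 0ℚ
δ-≢ {m} {k} k≢m with k ≟ₑ m
... | yes k≡m = contradiction k≡m k≢m
... | no  _   = refl

coeff-eval : ∀ f m → coeff f m ≡ eval (δ m) f
coeff-eval []            m = refl
coeff-eval ((c , k) ∷ f) m = cong₂ _+_ term (coeff-eval f m)
  where
  term : (if does (k ≟ₑ m) then c else 0ℚ) ≡ c * δ m k
  term with k ≟ₑ m
  ... | yes _ = sym (ℚ.*-identityʳ c)
  ... | no  _ = sym (ℚ.*-zeroʳ c)

-- Terms with equal exponents can be collected, so eval φ f depends only on φ and the
-- coefficients of f.
private
  collect : List Exponent → (Exponent → ℚ) → Polynomial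
  collect S a = map (λ m → a m , m) S

  collect-cong : ∀ {φ ψ a b} → (∀ m → a m * φ m ≡ b m * ψ m) →
                 ∀ S → eval φ (collect S a) ≡ eval ψ (collect S b)
  collect-cong eq []      = refl
  collect-cong eq (m ∷ S) = cong₂ _+_ (eq m) (collect-cong eq S)

  collect-0 : ∀ φ a {S} → All (λ m → a m ≡ 0ℚ) S → eval φ (collect S a) ≡ 0ℚ
  collect-0 φ a []                = refl
  collect-0 φ a {m ∷ S} (a≡0 ∷ all) =
    cong₂ _+_ (trans (cong (_* φ m) a≡0) (ℚ.*-zeroˡ (φ m))) (collect-0 φ a all)

  collect-+ : ∀ φ a b S → eval φ (collect S (λ m → a m + b m)) ≡ eval φ (collect S a) + eval φ (collect S b)
  collect-+ φ a b []      = refl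
  collect-+ φ a b (m ∷ S) =
    trans (cong₂ _+_ (ℚ.*-distribʳ-+ (φ m) (a m) (b m)) (collect-+ φ a b S))
          (+-interchange (a m * φ m) (b m * φ m) _ _)

  -- Since `S` has no duplicates, `k` is met exactly once and its term is counted exactly once.
  collect-single : ∀ φ c k {S} → Unique S → k ∈ S →
                   eval φ (collect S (λ m → if does (k ≟ₑ m) then c else 0ℚ)) ≡ c * φ k
  collect-single φ c k {m ∷ S} (m∉ ∷ S!) k∈ with k ≟ₑ m | k∈
  ... | yes refl | _ =
    trans (cong (λ x → c * φ k + x) (collect-0 φ _ (All.map off m∉))) (ℚ.+-identityʳ (c * φ k))
    where
    off : ∀ {m} → k ≢ m → (if does (k ≟ₑ m) then c else 0ℚ) ≡ 0ℚ
    off {m} k≢m with k ≟ₑ m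
    ... | yes k≡m = contradiction k≡m k≢m
    ... | no  _   = refl
  ... | no k≢m | here k≡m  = contradiction k≡m k≢m
  ... | no k≢m | there k∈S =
    trans (cong₂ _+_ (ℚ.*-zeroˡ (φ m)) (collect-single φ c k S! k∈S)) (ℚ.+-identityˡ _)

  eval-collect : ∀ φ f {S} → Unique S → (∀ {k} → k ∈ map proj₂ f → k ∈ S) →
                 eval φ f ≡ eval φ (collect S (coeff f))
  eval-collect φ []            {S} S! f⊆S = sym (collect-0 φ _ (All.universal (λ _ → refl) S))
  eval-collect φ ((c , k) ∷ f) {S} S! f⊆S = begin
    c * φ k + eval φ f
      ≡⟨ cong₂ _+_ (collect-single φ c k S! (f⊆S (here refl)))
                   (sym (eval-collect φ f S! (f⊆S ∘ there))) ⟨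
    eval φ (collect S (λ m → if does (k ≟ₑ m) then c else 0ℚ)) + eval φ (collect S (coeff f))
      ≡⟨ collect-+ φ _ (coeff f) S ⟨
    eval φ (collect S (coeff ((c , k) ∷ f))) ∎

-- Two functionals are allowed because it is used in two ways: `φ = ψ` shows that `_≈_` implies
-- `_≋_`, while `f = g` shows that only the values of `φ` at exponents with non-zero coefficient
-- matter.
eval-determined : ∀ {φ ψ} f g → (∀ m → coeff f m * φ m ≡ coeff g m * ψ m) → eval φ f ≡ eval ψ g
eval-determined {φ} {ψ} f g eq = begin
  eval φ f                       ≡⟨ eval-collect φ f S! (∈-deduplicate⁺ _≟ₑ_ ∘ ∈-++⁺ˡ) ⟩
  eval φ (collect S (coeff f))   ≡⟨ collect-cong eq S ⟩
  eval ψ (collect S (coeff g))   ≡⟨ eval-collect ψ g S! (∈-deduplicate⁺ _≟ₑ_ ∘ ∈-++⁺ʳ (map proj₂ f)) ⟨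
  eval ψ g                       ∎
  where
  -- One duplicate-free list containing the exponents of both polynomials, so that both sums are
  -- collected over the same index list.
  S  = deduplicate _≟ₑ_ (map proj₂ f ++ map proj₂ g)
  S! = DecUniqueₚ.deduplicate-! _≟ₑ_ (map proj₂ f ++ map proj₂ g)

-- A record, unlike _≈_, lets Agda infer the two polynomials.
infix 4 _≋_
record _≋_ (f g : Polynomial) : Set where
  constructor ext
  field at : ∀ φ → eval φ f ≡ eval φ g
open _≋_

≈⇒≋ : ∀ {f g} → f ≈ g → f ≋ g
≈⇒≋ {f} {g} f≈g .at φ = eval-determined f g λ m → cong (_* φ m) (f≈g m)

≋⇒≈ : ∀ {f g} → f ≋ g → f ≈ g
≋⇒≈ {f} {g} f≋g m = trans (coeff-eval f m) (trans (f≋g .at (δ m)) (sym (coeff-eval g m)))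

≋-refl : ∀ {f} → f ≋ f
≋-refl .at φ = refl

≋-sym : ∀ {f g} → f ≋ g → g ≋ f
≋-sym f≋g .at φ = sym (f≋g .at φ)

≋-trans : ∀ {f g h} → f ≋ g → g ≋ h → f ≋ h
≋-trans f≋g g≋h .at φ = trans (f≋g .at φ) (g≋h .at φ)

-- Multiplication

_⊞_ : Exponent → Exponent → Exponent
_⊞_ = zipWith ℕ._+_

-- Reduces each law of the product to the corresponding law for addition of exponents.
eval-*ₚ : ∀ φ f g → eval φ (f *ₚ g) ≡ eval (λ k → eval (λ m → φ (k ⊞ m)) g) f
eval-*ₚ φ []            g = refl
eval-*ₚ φ ((c , k) ∷ f) g =
  trans (eval-+ₚ φ (map (λ (d , m) → c * d , k ⊞ m) g) (f *ₚ g))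
        (cong₂ _+_ (shift g) (eval-*ₚ φ f g))
  where
  shift : ∀ g → eval φ (map (λ (d , m) → c * d , k ⊞ m) g) ≡ c * eval (λ m → φ (k ⊞ m)) g
  shift []            = sym (ℚ.*-zeroʳ c)
  shift ((d , m) ∷ g) =
    trans (cong₂ _+_ (ℚ.*-assoc c d _) (shift g)) (sym (ℚ.*-distribˡ-+ c (d * φ (k ⊞ m)) _))

*ₚ-cong : ∀ {f f′ g g′} → f ≋ f′ → g ≋ g′ → f *ₚ g ≋ f′ *ₚ g′
*ₚ-cong {f} {f′} {g} {g′} f≋f′ g≋g′ .at φ = begin
  eval φ (f *ₚ g)                                 ≡⟨ eval-*ₚ φ f g ⟩
  eval (λ k → eval (λ m → φ (k ⊞ m)) g) f         ≡⟨ f≋f′ .at _ ⟩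
  eval (λ k → eval (λ m → φ (k ⊞ m)) g) f′        ≡⟨ eval-cong (λ k → g≋g′ .at _) f′ ⟩
  eval (λ k → eval (λ m → φ (k ⊞ m)) g′) f′       ≡⟨ eval-*ₚ φ f′ g′ ⟨
  eval φ (f′ *ₚ g′)                               ∎

*ₚ-comm : ∀ f g → f *ₚ g ≋ g *ₚ f
*ₚ-comm f g .at φ = begin
  eval φ (f *ₚ g)                           ≡⟨ eval-*ₚ φ f g ⟩
  eval (λ k → eval (λ m → φ (k ⊞ m)) g) f   ≡⟨ eval-swap (λ k m → φ (k ⊞ m)) f g ⟩
  eval (λ m → eval (λ k → φ (k ⊞ m)) f) g
    ≡⟨ eval-cong (λ m → eval-cong (λ k → cong φ (Vec.zipWith-comm ℕ.+-comm k m)) f) g ⟩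
  eval (λ m → eval (λ k → φ (m ⊞ k)) f) g   ≡⟨ eval-*ₚ φ g f ⟨
  eval φ (g *ₚ f)                           ∎

*ₚ-assoc : ∀ f g h → (f *ₚ g) *ₚ h ≋ f *ₚ (g *ₚ h)
*ₚ-assoc f g h .at φ = begin
  eval φ ((f *ₚ g) *ₚ h)
    ≡⟨ eval-*ₚ φ (f *ₚ g) h ⟩
  eval (λ k → eval (λ n → φ (k ⊞ n)) h) (f *ₚ g)
    ≡⟨ eval-*ₚ _ f g ⟩
  eval (λ k → eval (λ m → eval (λ n → φ ((k ⊞ m) ⊞ n)) h) g) f
    ≡⟨ eval-cong (λ k → eval-cong (λ m → eval-cong (λ n → cong φ (Vec.zipWith-assoc ℕ.+-assoc k m n)) h) g) f ⟩
  eval (λ k → eval (λ m → eval (λ n → φ (k ⊞ (m ⊞ n))) h) g) f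
    ≡⟨ eval-cong (λ k → eval-*ₚ (λ m → φ (k ⊞ m)) g h) f ⟨
  eval (λ k → eval (λ m → φ (k ⊞ m)) (g *ₚ h)) f
    ≡⟨ eval-*ₚ φ f (g *ₚ h) ⟨
  eval φ (f *ₚ (g *ₚ h)) ∎

*ₚ-identityˡ : ∀ f → 1ₚ *ₚ f ≋ f
*ₚ-identityˡ f .at φ = begin
  eval φ (1ₚ *ₚ f)                             ≡⟨ eval-*ₚ φ 1ₚ f ⟩
  eval (λ k → eval (λ m → φ (k ⊞ m)) f) 1ₚ     ≡⟨ eval-x^ (λ k → eval (λ m → φ (k ⊞ m)) f) (replicate 3 0) ⟩
  eval (λ m → φ (replicate 3 0 ⊞ m)) f
    ≡⟨ eval-cong (λ m → cong φ (Vec.zipWith-identityˡ (λ _ → refl) m)) f ⟩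
  eval φ f                                     ∎

*ₚ-commutativeMonoid : CommutativeMonoid 0ℓ 0ℓ
*ₚ-commutativeMonoid = record
  { Carrier = Polynomial
  ; _≈_     = _≋_
  ; _∙_     = _*ₚ_
  ; ε       = 1ₚ
  ; isCommutativeMonoid = record
    { isMonoid = record
      { isSemigroup = record
        { isMagma = record
          { isEquivalence = record { refl = ≋-refl ; sym = ≋-sym ; trans = ≋-trans }
          ; ∙-cong        = *ₚ-cong
          }
        ; assoc = *ₚ-assoc
        }
      ; identity = *ₚ-identityˡ , λ f → ≋-trans (*ₚ-comm f 1ₚ) (*ₚ-identityˡ f)
      }
    ; comm = *ₚ-comm
    }
  }

open CommutativeMonoid *ₚ-commutativeMonoid using (commutativeSemigroup) renaming (identityʳ to *ₚ-identityʳ)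
open import Algebra.Properties.CommutativeSemigroup commutativeSemigroup
  using () renaming (interchange to *ₚ-interchange)

^ₚ-+ : ∀ f a b → f ^ₚ (a ℕ.+ b) ≋ f ^ₚ a *ₚ f ^ₚ b
^ₚ-+ f zero    b = ≋-sym (*ₚ-identityˡ (f ^ₚ b))
^ₚ-+ f (suc a) b =
  ≋-trans (*ₚ-cong (≋-refl {f}) (^ₚ-+ f a b)) (≋-sym (*ₚ-assoc f (f ^ₚ a) (f ^ₚ b)))

-- Linear operators

-- Linearity is encoded as having a transpose on functionals; necessarily `dual φ k` is the value of
-- `φ` on the image of `x^ k`. Term-by-term operators have one by recursion on the list, composites
-- compose transposes in reverse order, and compatibility with equality, sums and scalars follows at
-- once.
record Linear (T : Polynomial → Polynomial) : Set where
  field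
    dual    : (Exponent → ℚ) → Exponent → ℚ
    adjoint : ∀ φ f → eval φ (T f) ≡ eval (dual φ) f

  resp-≋ : ∀ {f g} → f ≋ g → T f ≋ T g
  resp-≋ {f} {g} f≋g .at φ =
    trans (adjoint φ f) (trans (f≋g .at (dual φ)) (sym (adjoint φ g)))

  resp-·ₚ : ∀ c f → T (c ·ₚ f) ≋ c ·ₚ T f
  resp-·ₚ c f .at φ = begin
    eval φ (T (c ·ₚ f))        ≡⟨ adjoint φ (c ·ₚ f) ⟩
    eval (dual φ) (c ·ₚ f)     ≡⟨ eval-·ₚ (dual φ) c f ⟩
    c * eval (dual φ) f        ≡⟨ cong (c *_) (adjoint φ f) ⟨
    c * eval φ (T f)           ≡⟨ eval-·ₚ φ c (T f) ⟨
    eval φ (c ·ₚ T f)          ∎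

  resp-+ₚ : ∀ f g → T (f +ₚ g) ≋ T f +ₚ T g
  resp-+ₚ f g .at φ = begin
    eval φ (T (f +ₚ g))                    ≡⟨ adjoint φ (f +ₚ g) ⟩
    eval (dual φ) (f +ₚ g)                 ≡⟨ eval-+ₚ (dual φ) f g ⟩
    eval (dual φ) f + eval (dual φ) g      ≡⟨ cong₂ _+_ (adjoint φ f) (adjoint φ g) ⟨
    eval φ (T f) + eval φ (T g)            ≡⟨ eval-+ₚ φ (T f) (T g) ⟨
    eval φ (T f +ₚ T g)                    ∎

open Linear

linear-0 : Linear (λ _ → 0ₚ)
linear-0 .dual φ k    = 0ℚ
linear-0 .adjoint φ f = sym (eval-0 f)

linear-+ₚ : ∀ {T U} → Linear T → Linear U → Linear (λ f → T f +ₚ U f)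
linear-+ₚ T U .dual φ k = T .dual φ k + U .dual φ k
linear-+ₚ {T₀} {U₀} T U .adjoint φ f =
  trans (eval-+ₚ φ (T₀ f) (U₀ f))
    (trans (cong₂ _+_ (T .adjoint φ f) (U .adjoint φ f))
           (sym (eval-+ (T .dual φ) (U .dual φ) f)))

linear-·ₚ : ∀ {T} c → Linear T → Linear (λ f → c ·ₚ T f)
linear-·ₚ c T .dual φ k = c * T .dual φ k
linear-·ₚ {T₀} c T .adjoint φ f =
  trans (eval-·ₚ φ c (T₀ f)) (trans (cong (c *_) (T .adjoint φ f)) (sym (eval-* c (T .dual φ) f)))

linear-∘ : ∀ {T U} → Linear T → Linear U → Linear (λ f → T (U f))
linear-∘ T U .dual φ = U .dual (T .dual φ)
linear-∘ {T₀} {U₀} T U .adjoint φ f = trans (T .adjoint φ (U₀ f)) (U .adjoint (T .dual φ) f)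

-- Homogeneous polynomials

𝓐-eval : ∀ {l φ ψ} f → 𝓐 l f → (∀ k → + degree k ≡ l → φ k ≡ ψ k) → eval φ f ≡ eval ψ f
𝓐-eval {l} {φ} {ψ} f f∈𝓐 φ≗ψ = eval-determined f f agree
  where
  agree : ∀ m → coeff f m * φ m ≡ coeff f m * ψ m
  agree m with coeff f m ℚ.≟ 0ℚ
  ... | yes c≡0 rewrite c≡0 = trans (ℚ.*-zeroˡ (φ m)) (sym (ℚ.*-zeroˡ (ψ m)))
  ... | no  c≢0 = cong (coeff f m *_) (φ≗ψ m (f∈𝓐 m c≢0))

𝓐-vanish : ∀ {l φ} f → 𝓐 l f → (∀ k → + degree k ≡ l → φ k ≡ 0ℚ) → eval φ f ≡ 0ℚ
𝓐-vanish f f∈𝓐 φ≗0 = trans (𝓐-eval f f∈𝓐 φ≗0) (eval-0 f)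

-- Converse of `𝓐-vanish`: homogeneity means annihilation by all functionals that vanish in degree
-- `l`. In this dual form it passes through products and linear operators.
𝓐-intro : ∀ {l} f → (∀ φ → (∀ k → + degree k ≡ l → φ k ≡ 0ℚ) → eval φ f ≡ 0ℚ) → 𝓐 l f
𝓐-intro {l} f vanish m c≢0 with + degree m ℤ.≟ l
... | yes eq = eq
... | no neq = contradiction
  -- If `m` does not have degree `l`, then `δ m` vanishes in degree `l`, which forces the
  -- coefficient at `m` to be zero.
  (trans (coeff-eval f m) (vanish (δ m) λ k eq → δ-≢ {m} {k} λ { refl → neq eq })) c≢0

𝓐-x^ : ∀ k → 𝓐 (+ degree k) (x^ k)
𝓐-x^ k = 𝓐-intro (x^ k) λ φ φ≗0 → trans (eval-x^ φ k) (φ≗0 k refl)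

𝓐-0ₚ : ∀ {l} → 𝓐 l 0ₚ
𝓐-0ₚ = 𝓐-intro 0ₚ λ _ _ → refl

𝓐-+ₚ : ∀ {l} f g → 𝓐 l f → 𝓐 l g → 𝓐 l (f +ₚ g)
𝓐-+ₚ f g f∈𝓐 g∈𝓐 = 𝓐-intro (f +ₚ g) λ φ φ≗0 →
  trans (eval-+ₚ φ f g) (cong₂ _+_ (𝓐-vanish f f∈𝓐 φ≗0) (𝓐-vanish g g∈𝓐 φ≗0))

𝓐-·ₚ : ∀ {l} c f → 𝓐 l f → 𝓐 l (c ·ₚ f)
𝓐-·ₚ c f f∈𝓐 = 𝓐-intro (c ·ₚ f) λ φ φ≗0 →
  trans (eval-·ₚ φ c f) (trans (cong (c *_) (𝓐-vanish f f∈𝓐 φ≗0)) (ℚ.*-zeroʳ c))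

degree-⊞ : ∀ k m → degree (k ⊞ m) ≡ degree k ℕ.+ degree m
degree-⊞ (k₁ ∷ k₂ ∷ k₃ ∷ []) (m₁ ∷ m₂ ∷ m₃ ∷ []) =
  solve 6 (λ k₁ k₂ k₃ m₁ m₂ m₃ →
      (k₁ :+ m₁) :+ ((k₂ :+ m₂) :+ ((k₃ :+ m₃) :+ con 0))
    := (k₁ :+ (k₂ :+ (k₃ :+ con 0))) :+ (m₁ :+ (m₂ :+ (m₃ :+ con 0)))) refl k₁ k₂ k₃ m₁ m₂ m₃
  where
  open ℕ-Solver.+-*-Solver

𝓐-*ₚ : ∀ {a b} f g → 𝓐 a f → 𝓐 b g → 𝓐 (a ℤ.+ b) (f *ₚ g)
𝓐-*ₚ f g f∈𝓐 g∈𝓐 = 𝓐-intro (f *ₚ g) λ φ φ≗0 →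
  trans (eval-*ₚ φ f g)
    (𝓐-vanish f f∈𝓐 λ k k∈ → 𝓐-vanish g g∈𝓐 λ m m∈ →
      φ≗0 (k ⊞ m) (trans (cong +_ (degree-⊞ k m)) (cong₂ ℤ._+_ k∈ m∈)))

𝓐-^ₚ : ∀ f → 𝓐 (+ 1) f → ∀ n → 𝓐 (+ n) (f ^ₚ n)
𝓐-^ₚ f f∈𝓐 zero    = 𝓐-x^ (replicate 3 0)
𝓐-^ₚ f f∈𝓐 (suc n) = 𝓐-*ₚ f (f ^ₚ n) f∈𝓐 (𝓐-^ₚ f f∈𝓐 n)

-- The Laplacian

linear-∂ : ∀ i → Linear (∂ i)
linear-∂ i .dual φ k = fromℤ (+ lookup k i) * φ (k [ i ]%= ℕ.pred)
linear-∂ i .adjoint φ [] = refl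
linear-∂ i .adjoint φ ((c , k) ∷ f) = cong₂ _+_ (ℚ.*-assoc c _ _) (linear-∂ i .adjoint φ f)

sum-pred : ∀ {n} (k : Vec ℕ n) i {a} → lookup k i ≡ suc a → suc (Vec.sum (k [ i ]%= ℕ.pred)) ≡ Vec.sum k
sum-pred (suc k ∷ ks) zero    eq = refl
sum-pred (k ∷ ks)     (suc i) eq = trans (sym (ℕ.+-suc k _)) (cong (k ℕ.+_) (sum-pred ks i eq))

𝓐-∂ : ∀ {l} i f → 𝓐 l f → 𝓐 (ℤ.pred l) (∂ i f)
𝓐-∂ {l} i f f∈𝓐 = 𝓐-intro (∂ i f) λ φ φ≗0 →
  trans (linear-∂ i .adjoint φ f) (𝓐-vanish f f∈𝓐 (dual-vanish φ φ≗0))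
  where
  dual-vanish : ∀ φ → (∀ k → + degree k ≡ ℤ.pred l → φ k ≡ 0ℚ) →
                ∀ k → + degree k ≡ l → linear-∂ i .dual φ k ≡ 0ℚ
  dual-vanish φ φ≗0 k k∈ with lookup k i in eq
  -- Here `ℕ.pred` fails to lower the degree, but the factor brought down by differentiation is
  -- zero.
  ... | zero  = ℚ.*-zeroˡ (φ (k [ i ]%= ℕ.pred))
  ... | suc a =
    trans (cong (fromℤ (+ suc a) *_)
            (φ≗0 (k [ i ]%= ℕ.pred) (cong ℤ.pred (trans (cong +_ (sum-pred k i eq)) k∈))))
          (ℚ.*-zeroʳ (fromℤ (+ suc a)))

linear-Δ-Q : Linear Δ-Q
linear-Δ-Q = linear-·ₚ ½
  (linear-+ₚ (linear-+ₚ (linear-+ₚ (linear-+ₚ (linear-+ₚ (∂∂ 0F 0F) (∂∂ 1F 1F)) (∂∂ 2F 2F))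
    (∂∂ 0F 1F)) (∂∂ 1F 2F)) (∂∂ 2F 0F))
  where
  ∂∂ : ∀ i j → Linear (λ f → ∂ i (∂ j f))
  ∂∂ i j = linear-∘ {∂ i} {∂ j} (linear-∂ i) (linear-∂ j)

-- For `l` below 2 the target degree is negative, no exponent has it, and the claim says that the
-- Laplacian is zero.
𝓐-Δ-Q : ∀ {l} f → 𝓐 l f → 𝓐 (l - + 2) (Δ-Q f)
𝓐-Δ-Q {l} f f∈𝓐 =
  𝓐-·ₚ ½ (f₅ +ₚ ∂ 2F (∂ 0F f)) (𝓐-+ₚ f₅ (∂ 2F (∂ 0F f))
    (𝓐-+ₚ f₄ (∂ 1F (∂ 2F f))
      (𝓐-+ₚ f₃ (∂ 0F (∂ 1F f))
        (𝓐-+ₚ f₂ (∂ 2F (∂ 2F f))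
          (𝓐-+ₚ (∂ 0F (∂ 0F f)) (∂ 1F (∂ 1F f)) (∂∂ 0F 0F) (∂∂ 1F 1F))
          (∂∂ 2F 2F))
        (∂∂ 0F 1F))
      (∂∂ 1F 2F))
    (∂∂ 2F 0F))
  where
  pred² : ℤ.pred (ℤ.pred l) ≡ l - + 2
  pred² = trans (sym (ℤ.+-assoc (ℤ.- + 1) (ℤ.- + 1) l)) (ℤ.+-comm (ℤ.- + 2) l)
  f₂ f₃ f₄ f₅ : Polynomial
  f₂ = ∂ 0F (∂ 0F f) +ₚ ∂ 1F (∂ 1F f)
  f₃ = f₂ +ₚ ∂ 2F (∂ 2F f)
  f₄ = f₃ +ₚ ∂ 0F (∂ 1F f)
  f₅ = f₄ +ₚ ∂ 1F (∂ 2F f)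
  ∂∂ : ∀ i j → 𝓐 (l - + 2) (∂ i (∂ j f))
  ∂∂ i j = subst (λ n → 𝓐 n (∂ i (∂ j f))) pred² (𝓐-∂ i (∂ j f) (𝓐-∂ j f f∈𝓐))

-- Linear substitutions

-- The image of `x^ k` under substitution: the product inside the local `substitute` of `_∙_`, named
-- so that the transpose can refer to it.
monomialImage : Mat₃ → Exponent → Polynomial
monomialImage γ (k₁ ∷ k₂ ∷ k₃ ∷ []) =
  linearForm γ zero ^ₚ k₁ *ₚ linearForm γ (suc zero) ^ₚ k₂ *ₚ linearForm γ (suc (suc zero)) ^ₚ k₃

linear-∙ : ∀ γ → Linear (γ ∙_)
linear-∙ γ .dual φ k = eval φ (monomialImage γ k)
linear-∙ γ .adjoint φ [] = refl
linear-∙ γ .adjoint φ ((c , k@(_ ∷ _ ∷ _ ∷ [])) ∷ f) =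
  trans (eval-+ₚ φ (c ·ₚ monomialImage γ k) (γ ∙ f))
        (cong₂ _+_ (eval-·ₚ φ c (monomialImage γ k)) (linear-∙ γ .adjoint φ f))

monomialImage-⊞ : ∀ γ k m → monomialImage γ (k ⊞ m) ≋ monomialImage γ k *ₚ monomialImage γ m
monomialImage-⊞ γ (k₁ ∷ k₂ ∷ k₃ ∷ []) (m₁ ∷ m₂ ∷ m₃ ∷ []) =
  ≋-trans (*ₚ-cong (*ₚ-cong (^ₚ-+ L₁ k₁ m₁) (^ₚ-+ L₂ k₂ m₂)) (^ₚ-+ L₃ k₃ m₃))
    (≋-trans (*ₚ-cong (*ₚ-interchange (L₁ ^ₚ k₁) (L₁ ^ₚ m₁) (L₂ ^ₚ k₂) (L₂ ^ₚ m₂)) ≋-refl)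
             (*ₚ-interchange (L₁ ^ₚ k₁ *ₚ L₂ ^ₚ k₂) (L₁ ^ₚ m₁ *ₚ L₂ ^ₚ m₂) (L₃ ^ₚ k₃) (L₃ ^ₚ m₃)))
  where
  L₁ = linearForm γ zero
  L₂ = linearForm γ (suc zero)
  L₃ = linearForm γ (suc (suc zero))

∙-*ₚ : ∀ γ f g → γ ∙ (f *ₚ g) ≋ (γ ∙ f) *ₚ (γ ∙ g)
∙-*ₚ γ f g .at φ = begin
  eval φ (γ ∙ (f *ₚ g))
    ≡⟨ linear-∙ γ .adjoint φ (f *ₚ g) ⟩
  eval (λ k → eval φ (S k)) (f *ₚ g)
    ≡⟨ eval-*ₚ (λ k → eval φ (S k)) f g ⟩
  eval (λ k → eval (λ m → eval φ (S (k ⊞ m))) g) f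
    ≡⟨ eval-cong (λ k → eval-cong (λ m →
         trans (monomialImage-⊞ γ k m .at φ) (eval-*ₚ φ (S k) (S m))) g) f ⟩
  eval (λ k → eval (λ m → eval (λ a → eval (λ b → φ (a ⊞ b)) (S m)) (S k)) g) f
    -- The sum over the terms of `g` moves inside the expansion of `S k`, where it can be absorbed
    -- into `γ ∙ g`.
    ≡⟨ eval-cong (λ k → eval-swap (λ m a → eval (λ b → φ (a ⊞ b)) (S m)) g (S k)) f ⟩
  eval (λ k → eval (λ a → eval (λ m → eval (λ b → φ (a ⊞ b)) (S m)) g) (S k)) f
    ≡⟨ eval-cong (λ k → eval-cong (λ a → linear-∙ γ .adjoint (λ b → φ (a ⊞ b)) g) (S k)) f ⟨
  eval (λ k → eval (λ a → eval (λ b → φ (a ⊞ b)) (γ ∙ g)) (S k)) f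
    ≡⟨ linear-∙ γ .adjoint (λ a → eval (λ b → φ (a ⊞ b)) (γ ∙ g)) f ⟨
  eval (λ a → eval (λ b → φ (a ⊞ b)) (γ ∙ g)) (γ ∙ f)
    ≡⟨ eval-*ₚ φ (γ ∙ f) (γ ∙ g) ⟨
  eval φ ((γ ∙ f) *ₚ (γ ∙ g)) ∎
  where S = monomialImage γ

∙-1ₚ : ∀ γ → γ ∙ 1ₚ ≋ 1ₚ
∙-1ₚ γ .at φ = refl

∙-^ₚ : ∀ γ f n → γ ∙ (f ^ₚ n) ≋ (γ ∙ f) ^ₚ n
∙-^ₚ γ f zero    = ∙-1ₚ γ
∙-^ₚ γ f (suc n) = ≋-trans (∙-*ₚ γ f (f ^ₚ n)) (*ₚ-cong (≋-refl {γ ∙ f}) (∙-^ₚ γ f n))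

^ₚ-cong : ∀ {f g} → f ≋ g → ∀ n → f ^ₚ n ≋ g ^ₚ n
^ₚ-cong f≋g zero    = ≋-refl
^ₚ-cong f≋g (suc n) = *ₚ-cong f≋g (^ₚ-cong f≋g n)

-- Coordinate `j` of `(x γ) γ′ = x (γ γ′)`. Acting on row vectors from the right makes `_∙_` a left
-- action.
∙-linearForm : ∀ γ γ′ j → γ ∙ linearForm γ′ j ≋ linearForm (γ ⊗ γ′) j
∙-linearForm γ@(_ ∷ _ ∷ _ ∷ []) γ′ j .at φ = begin
  eval φ (γ ∙ linearForm γ′ j)
    ≡⟨ linear-∙ γ .adjoint φ (linearForm γ′ j) ⟩
  e′ 0F * eval φ (S (1 ∷ 0 ∷ 0 ∷ []))
    + (e′ 1F * eval φ (S (0 ∷ 1 ∷ 0 ∷ [])) + (e′ 2F * eval φ (S (0 ∷ 0 ∷ 1 ∷ [])) + 0ℚ))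
    ≡⟨ cong₂ _+_ (cong (e′ 0F *_) (image₁ .at φ)) (cong₂ _+_ (cong (e′ 1F *_) (image₂ .at φ))
         (cong (_+ 0ℚ) (cong (e′ 2F *_) (image₃ .at φ)))) ⟩
  e′ 0F * eval φ (linearForm γ 0F) + (e′ 1F * eval φ (linearForm γ 1F) + (e′ 2F * eval φ (linearForm γ 2F) + 0ℚ))
    -- The letters `a`, `b`, `c` are the rows of `γ`, `u v w` is column `j` of `γ′`, and `x y z` are
    -- the values of `φ` at the three variables. The identity exchanges the two summations of a
    -- matrix product.
    ≡⟨ solve 15 (λ a₀ a₁ a₂ b₀ b₁ b₂ c₀ c₁ c₂ x y z u v w →
         u :* (a₀ :* x :+ (b₀ :* y :+ (c₀ :* z :+ con 0ℚ)))
           :+ (v :* (a₁ :* x :+ (b₁ :* y :+ (c₁ :* z :+ con 0ℚ)))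
           :+ (w :* (a₂ :* x :+ (b₂ :* y :+ (c₂ :* z :+ con 0ℚ))) :+ con 0ℚ))
         := (a₀ :* u :+ (a₁ :* v :+ (a₂ :* w :+ con 0ℚ))) :* x
           :+ ((b₀ :* u :+ (b₁ :* v :+ (b₂ :* w :+ con 0ℚ))) :* y
           :+ ((c₀ :* u :+ (c₁ :* v :+ (c₂ :* w :+ con 0ℚ))) :* z :+ con 0ℚ)))
         refl (e 0F 0F) (e 0F 1F) (e 0F 2F) (e 1F 0F) (e 1F 1F) (e 1F 2F) (e 2F 0F) (e 2F 1F) (e 2F 2F)
         (φ (1 ∷ 0 ∷ 0 ∷ [])) (φ (0 ∷ 1 ∷ 0 ∷ [])) (φ (0 ∷ 0 ∷ 1 ∷ [])) (e′ 0F) (e′ 1F) (e′ 2F) ⟩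
  product 0F * φ (1 ∷ 0 ∷ 0 ∷ []) + (product 1F * φ (0 ∷ 1 ∷ 0 ∷ []) + (product 2F * φ (0 ∷ 0 ∷ 1 ∷ []) + 0ℚ))
    ≡⟨ cong₂ _+_ (cong₂ _*_ (entry-⊗ 0F) refl) (cong₂ _+_ (cong₂ _*_ (entry-⊗ 1F) refl)
         (cong (_+ 0ℚ) (cong₂ _*_ (entry-⊗ 2F) refl))) ⟨
  eval φ (linearForm (γ ⊗ γ′) j) ∎
  where
  open +-*-Solver
  S  = monomialImage γ
  e  = entry γ
  e′ : Fin 3 → ℚ
  e′ i = entry γ′ i j
  product : Fin 3 → ℚ
  product k = e k 0F * e′ 0F + (e k 1F * e′ 1F + (e k 2F * e′ 2F + 0ℚ))
  entry-⊗ : ∀ k → entry (γ ⊗ γ′) k j ≡ product k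
  entry-⊗ k = trans (cong (λ row → lookup row j) (Vec.lookup-map k (_ᵥ⊗ γ′) γ))
    (Vec.lookup∘tabulate (λ j → sum λ i → e k i * entry γ′ i j) j)
  image₁ : S (1 ∷ 0 ∷ 0 ∷ []) ≋ linearForm γ 0F
  image₁ = ≋-trans (*ₚ-identityʳ _) (≋-trans (*ₚ-identityʳ _) (*ₚ-identityʳ _))
  image₂ : S (0 ∷ 1 ∷ 0 ∷ []) ≋ linearForm γ 1F
  image₂ = ≋-trans (*ₚ-identityʳ _) (≋-trans (*ₚ-identityˡ _) (*ₚ-identityʳ _))
  image₃ : S (0 ∷ 0 ∷ 1 ∷ []) ≋ linearForm γ 2F
  image₃ = ≋-trans (*ₚ-cong (*ₚ-identityˡ 1ₚ) (≋-refl {linearForm γ 2F *ₚ 1ₚ}))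
    (≋-trans (*ₚ-identityˡ _) (*ₚ-identityʳ _))

∙-monomialImage : ∀ γ γ′ k → γ ∙ monomialImage γ′ k ≋ monomialImage (γ ⊗ γ′) k
∙-monomialImage γ γ′ (k₁ ∷ k₂ ∷ k₃ ∷ []) =
  ≋-trans (∙-*ₚ γ (p₁ *ₚ p₂) p₃)
    (*ₚ-cong (≋-trans (∙-*ₚ γ p₁ p₂) (*ₚ-cong (power zero k₁) (power (suc zero) k₂))) (power (suc (suc zero)) k₃))
  where
  p₁ = linearForm γ′ zero ^ₚ k₁
  p₂ = linearForm γ′ (suc zero) ^ₚ k₂
  p₃ = linearForm γ′ (suc (suc zero)) ^ₚ k₃
  power : ∀ j n → γ ∙ (linearForm γ′ j ^ₚ n) ≋ linearForm (γ ⊗ γ′) j ^ₚ n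
  power j n = ≋-trans (∙-^ₚ γ (linearForm γ′ j) n) (^ₚ-cong (∙-linearForm γ γ′ j) n)

-- By linearity the comparison takes place on monomials; there, both sides being multiplicative, it
-- reduces to the three linear forms.
∙-∙ : ∀ γ γ′ f → γ ∙ (γ′ ∙ f) ≋ (γ ⊗ γ′) ∙ f
∙-∙ γ γ′ f .at φ = begin
  eval φ (γ ∙ (γ′ ∙ f))
    ≡⟨ linear-∙ γ .adjoint φ (γ′ ∙ f) ⟩
  eval (λ k → eval φ (monomialImage γ k)) (γ′ ∙ f)
    ≡⟨ linear-∙ γ′ .adjoint _ f ⟩
  eval (λ k → eval (λ m → eval φ (monomialImage γ m)) (monomialImage γ′ k)) f
    ≡⟨ eval-cong (λ k → trans (sym (linear-∙ γ .adjoint φ (monomialImage γ′ k)))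
                              (∙-monomialImage γ γ′ k .at φ)) f ⟩
  eval (λ k → eval φ (monomialImage (γ ⊗ γ′) k)) f
    ≡⟨ linear-∙ (γ ⊗ γ′) .adjoint φ f ⟨
  eval φ ((γ ⊗ γ′) ∙ f) ∎

𝓐-linearForm : ∀ γ j → 𝓐 (+ 1) (linearForm γ j)
𝓐-linearForm γ j = 𝓐-intro (linearForm γ j) λ φ φ≗0 →
  cong₂ _+_ (term φ φ≗0 zero refl) (cong₂ _+_ (term φ φ≗0 (suc zero) refl)
    (cong (_+ 0ℚ) (term φ φ≗0 (suc (suc zero)) refl)))
  where
  term : ∀ φ → (∀ k → + degree k ≡ + 1 → φ k ≡ 0ℚ) → ∀ i →
         degree (replicate 3 0 [ i ]%= suc) ≡ 1 → entry γ i j * φ (replicate 3 0 [ i ]%= suc) ≡ 0ℚ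
  term φ φ≗0 i deg = trans (cong (entry γ i j *_) (φ≗0 _ (cong +_ deg))) (ℚ.*-zeroʳ (entry γ i j))

𝓐-monomialImage : ∀ γ k → 𝓐 (+ degree k) (monomialImage γ k)
𝓐-monomialImage γ (k₁ ∷ k₂ ∷ k₃ ∷ []) =
  subst (λ n → 𝓐 (+ n) (monomialImage γ (k₁ ∷ k₂ ∷ k₃ ∷ [])))
    (trans (ℕ.+-assoc k₁ k₂ k₃) (cong (λ n → k₁ ℕ.+ (k₂ ℕ.+ n)) (sym (ℕ.+-identityʳ k₃))))
    (𝓐-*ₚ (p₁ *ₚ p₂) p₃ (𝓐-*ₚ p₁ p₂ (power zero k₁) (power (suc zero) k₂)) (power (suc (suc zero)) k₃))
  where
  p₁ = linearForm γ zero ^ₚ k₁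
  p₂ = linearForm γ (suc zero) ^ₚ k₂
  p₃ = linearForm γ (suc (suc zero)) ^ₚ k₃
  power : ∀ j n → 𝓐 (+ n) (linearForm γ j ^ₚ n)
  power j = 𝓐-^ₚ (linearForm γ j) (𝓐-linearForm γ j)

𝓐-∙ : ∀ {l} γ f → 𝓐 l f → 𝓐 l (γ ∙ f)
𝓐-∙ {l} γ f f∈𝓐 = 𝓐-intro (γ ∙ f) λ φ φ≗0 →
  trans (linear-∙ γ .adjoint φ f)
    (𝓐-vanish f f∈𝓐 λ k k∈ →
      𝓐-vanish (monomialImage γ k) (subst (λ n → 𝓐 n (monomialImage γ k)) k∈ (𝓐-monomialImage γ k)) φ≗0)

-- Matrices and coordinates

sum-single : ∀ {n} (a d : Vector ℚ n) i → d i ≡ 1ℚ → (∀ j → j ≢ i → d j ≡ 0ℚ) →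
             sum (λ j → a j * d j) ≡ a i
sum-single {suc n} a d zero    dᵢ≡1 dⱼ≡0 =
  trans (cong₂ _+_ (trans (cong (a zero *_) dᵢ≡1) (ℚ.*-identityʳ (a zero)))
                   (rest (a ∘ suc) (d ∘ suc) λ j → dⱼ≡0 (suc j) λ ()))
        (ℚ.+-identityʳ (a zero))
  where
  rest : ∀ {n} (a d : Vector ℚ n) → (∀ j → d j ≡ 0ℚ) → sum (λ j → a j * d j) ≡ 0ℚ
  rest {zero}  a d d≡0 = refl
  rest {suc n} a d d≡0 =
    cong₂ _+_ (trans (cong (a zero *_) (d≡0 zero)) (ℚ.*-zeroʳ (a zero))) (rest (a ∘ suc) (d ∘ suc) (d≡0 ∘ suc))
sum-single {suc n} a d (suc i) dᵢ≡1 dⱼ≡0 =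
  trans (cong₂ _+_ (trans (cong (a zero *_) (dⱼ≡0 zero λ ())) (ℚ.*-zeroʳ (a zero)))
                   (sum-single (a ∘ suc) (d ∘ suc) i dᵢ≡1 λ j j≢i → dⱼ≡0 (suc j) (j≢i ∘ suc-injective)))
        (ℚ.+-identityˡ (a (suc i)))

*ᵥ-cong : ∀ {m n} (A : Matrix m n) {v w} → (∀ j → v j ≡ w j) → ∀ i → (A *ᵥ v) i ≡ (A *ᵥ w) i
*ᵥ-cong A v≗w i = sum-cong-≗ λ j → cong (A i j *_) (v≗w j)

*ₘ-*ᵥ : ∀ {m n p} (A : Matrix m n) (B : Matrix n p) v i → ((A *ₘ B) *ᵥ v) i ≡ (A *ᵥ (B *ᵥ v)) i
*ₘ-*ᵥ A B v i = begin
  sum (λ k → sum (λ j → A i j * B j k) * v k)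
    ≡⟨ sum-cong-≗ (λ k → *-distribʳ-sum (v k) (λ j → A i j * B j k)) ⟩
  sum (λ k → sum (λ j → A i j * B j k * v k))
    ≡⟨ ∑-comm (λ k j → A i j * B j k * v k) ⟩
  sum (λ j → sum (λ k → A i j * B j k * v k))
    ≡⟨ sum-cong-≗ (λ j → sum-cong-≗ λ k → ℚ.*-assoc (A i j) (B j k) (v k)) ⟩
  sum (λ j → sum (λ k → A i j * (B j k * v k)))
    ≡⟨ sum-cong-≗ (λ j → *-distribˡ-sum (A i j) (λ k → B j k * v k)) ⟨
  sum (λ j → A i j * sum (λ k → B j k * v k)) ∎

linearCombination-ℚ^ : ∀ {m n} (c : Vector ℚ n) (vs : Vector (Vector ℚ m) n) i →
                       linearCombination (ℚ^ m) c vs i ≡ sum (λ j → c j * vs j i)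
linearCombination-ℚ^ {n = zero}  c vs i = refl
linearCombination-ℚ^ {n = suc n} c vs i =
  cong (λ x → c zero * vs zero i + x) (linearCombination-ℚ^ (c ∘ suc) (vs ∘ suc) i)

*ᵥ-columns : ∀ {m n} (A : Matrix m n) v i → (A *ᵥ v) i ≡ linearCombination (ℚ^ m) v (transpose A) i
*ᵥ-columns A v i =
  trans (sum-cong-≗ λ j → ℚ.*-comm (A i j) (v j)) (sym (linearCombination-ℚ^ v (transpose A) i))

*ᵥ-linearCombination : ∀ {m n t} (A : Matrix m n) (c : Vector ℚ t) vs i →
                       (A *ᵥ linearCombination (ℚ^ n) c vs) i ≡ sum (λ k → c k * (A *ᵥ vs k) i)
*ᵥ-linearCombination A c vs i = begin
  sum (λ j → A i j * linearCombination (ℚ^ _) c vs j)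
    ≡⟨ sum-cong-≗ (λ j → cong (A i j *_) (linearCombination-ℚ^ c vs j)) ⟩
  sum (λ j → A i j * sum (λ k → c k * vs k j))
    ≡⟨ sum-cong-≗ (λ j → *-distribˡ-sum (A i j) (λ k → c k * vs k j)) ⟩
  sum (λ j → sum (λ k → A i j * (c k * vs k j)))
    ≡⟨ ∑-comm (λ j k → A i j * (c k * vs k j)) ⟩
  sum (λ k → sum (λ j → A i j * (c k * vs k j)))
    ≡⟨ sum-cong-≗ (λ k → sum-cong-≗ λ j →
         solve 3 (λ a c v → a :* (c :* v) := c :* (a :* v)) refl (A i j) (c k) (vs k j)) ⟩
  sum (λ k → sum (λ j → c k * (A i j * vs k j)))
    ≡⟨ sum-cong-≗ (λ k → *-distribˡ-sum (c k) (λ j → A i j * vs k j)) ⟨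
  sum (λ k → c k * (A *ᵥ vs k) i) ∎
  where open +-*-Solver

eval-linearCombination : ∀ φ {n} (c : Vector ℚ n) fs →
                         eval φ (linearCombination polynomials c fs) ≡ sum (λ i → c i * eval φ (fs i))
eval-linearCombination φ {zero}  c fs = refl
eval-linearCombination φ {suc n} c fs =
  trans (eval-+ₚ φ (c zero ·ₚ fs zero) (linearCombination polynomials (c ∘ suc) (fs ∘ suc)))
        (cong₂ _+_ (eval-·ₚ φ (c zero) (fs zero)) (eval-linearCombination φ (c ∘ suc) (fs ∘ suc)))

coeff-linearCombination : ∀ m {n} (c : Vector ℚ n) fs →
                          coeff (linearCombination polynomials c fs) m ≡ sum (λ i → c i * coeff (fs i) m)
coeff-linearCombination m c fs =
  trans (coeff-eval (linearCombination polynomials c fs) m)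
    (trans (eval-linearCombination (δ m) c fs) (sum-cong-≗ λ i → cong (c i *_) (sym (coeff-eval (fs i) m))))

linear-linearCombination : ∀ {T} → Linear T → ∀ {n} (c : Vector ℚ n) fs →
  T (linearCombination polynomials c fs) ≋ linearCombination polynomials c (T ∘ fs)
linear-linearCombination {T₀} T c fs .at φ = begin
  eval φ (T₀ (linearCombination polynomials c fs))       ≡⟨ T .adjoint φ _ ⟩
  eval (T .dual φ) (linearCombination polynomials c fs)  ≡⟨ eval-linearCombination (T .dual φ) c fs ⟩
  sum (λ i → c i * eval (T .dual φ) (fs i))              ≡⟨ sum-cong-≗ (λ i → cong (c i *_) (T .adjoint φ (fs i))) ⟨
  sum (λ i → c i * eval φ (T₀ (fs i)))                   ≡⟨ eval-linearCombination φ c (T₀ ∘ fs) ⟨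
  eval φ (linearCombination polynomials c (T₀ ∘ fs))     ∎

𝓐-linearCombination : ∀ {l n} (c : Vector ℚ n) fs → (∀ i → 𝓐 l (fs i)) → 𝓐 l (linearCombination polynomials c fs)
𝓐-linearCombination {n = zero}  c fs fs∈𝓐 = 𝓐-0ₚ
𝓐-linearCombination {n = suc n} c fs fs∈𝓐 =
  𝓐-+ₚ (c zero ·ₚ fs zero) _ (𝓐-·ₚ (c zero) (fs zero) (fs∈𝓐 zero))
       (𝓐-linearCombination (c ∘ suc) (fs ∘ suc) (fs∈𝓐 ∘ suc))

eval-sum : ∀ {n} (a : Vector ℚ n) (ψ : Fin n → Exponent → ℚ) f →
           eval (λ k → sum (λ i → a i * ψ i k)) f ≡ sum (λ i → a i * eval (ψ i) f)
eval-sum {zero}  a ψ f = eval-0 f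
eval-sum {suc n} a ψ f =
  trans (eval-+ (λ k → a zero * ψ zero k) _ f)
        (cong₂ _+_ (eval-* (a zero) (ψ zero) f) (eval-sum (a ∘ suc) (ψ ∘ suc) f))

module _ {l} (order : MonomialOrder l) where

  exponent-degree : ∀ i → + degree (exponent order i) ≡ l
  exponent-degree i = proj₂ (Inverse.to order i)

  index : ∀ {k} → + degree k ≡ l → Fin (dim l)
  index {k} k∈ = Inverse.from order (k , k∈)

  exponent-index : ∀ {k} (k∈ : + degree k ≡ l) → exponent order (index k∈) ≡ k
  exponent-index k∈ = cong proj₁ (Inverse.strictlyInverseˡ order (_ , k∈))

  exponent-injective : ∀ {i j} → exponent order i ≡ exponent order j → i ≡ j
  exponent-injective {i} {j} eq = begin
    i                                              ≡⟨ Inverse.strictlyInverseʳ order i ⟨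
    Inverse.from order (Inverse.to order i)        ≡⟨ cong (Inverse.from order) (monomial-≡ eq) ⟩
    Inverse.from order (Inverse.to order j)        ≡⟨ Inverse.strictlyInverseʳ order j ⟩
    j                                              ∎
    where
    monomial-≡ : ∀ {p q : Monomial l} → proj₁ p ≡ proj₁ q → p ≡ q
    monomial-≡ {k , p} {.k , q} refl = cong (k ,_) (Decidable⇒UIP.≡-irrelevant ℤ._≟_ p q)

  𝓐-𝓕⁻¹ : ∀ v → 𝓐 l (𝓕⁻¹ order v)
  𝓐-𝓕⁻¹ v = 𝓐-linearCombination v _ λ i →
    subst (λ n → 𝓐 n (x^ exponent order i)) (exponent-degree i) (𝓐-x^ (exponent order i))

  𝓕-𝓕⁻¹ : ∀ v i → 𝓕 order (𝓕⁻¹ order v) i ≡ v i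
  𝓕-𝓕⁻¹ v i = trans
    (coeff-linearCombination (exponent order i) v (λ j → x^ exponent order j))
    (sum-single v (λ j → coeff (x^ exponent order j) (exponent order i)) i
      (trans (coeff-x^ i) (δ-refl (exponent order i)))
      λ j j≢i → trans (coeff-x^ j) (δ-≢ {exponent order i} {exponent order j} (j≢i ∘ exponent-injective)))
    where
    coeff-x^ : ∀ j → coeff (x^ exponent order j) (exponent order i) ≡ δ (exponent order i) (exponent order j)
    coeff-x^ j = ℚ.+-identityʳ (δ (exponent order i) (exponent order j))

  -- Dually, in degree `l` every `φ` is a combination of the `δ` at the enumerated exponents, and on
  -- a homogeneous `f` only that degree counts.
  𝓕⁻¹-𝓕 : ∀ f → 𝓐 l f → 𝓕⁻¹ order (𝓕 order f) ≋ f
  𝓕⁻¹-𝓕 f f∈𝓐 .at φ = begin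
    eval φ (𝓕⁻¹ order (𝓕 order f))
      ≡⟨ eval-linearCombination φ (𝓕 order f) _ ⟩
    sum (λ i → coeff f (e i) * eval φ (x^ e i))
      ≡⟨ sum-cong-≗ (λ i → trans (cong₂ _*_ (coeff-eval f (e i)) (eval-x^ φ (e i))) (ℚ.*-comm _ (φ (e i)))) ⟩
    sum (λ i → φ (e i) * eval (δ (e i)) f)
      ≡⟨ eval-sum (φ ∘ e) (δ ∘ e) f ⟨
    eval (λ k → sum (λ i → φ (e i) * δ (e i) k)) f
      ≡⟨ 𝓐-eval f f∈𝓐 expand ⟩
    eval φ f ∎
    where
    e = exponent order
    expand : ∀ k → + degree k ≡ l → sum (λ i → φ (e i) * δ (e i) k) ≡ φ k
    expand k k∈ = subst (λ k → sum (λ i → φ (e i) * δ (e i) k) ≡ φ k) (exponent-index k∈)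
      (sum-single (φ ∘ e) (λ i → δ (e i) (e i₀)) i₀ (δ-refl (e i₀))
        λ i i≢i₀ → δ-≢ {e i} {e i₀} λ eq → i≢i₀ (exponent-injective (sym eq)))
      where i₀ = index k∈

  𝓐-ext : ∀ f g → 𝓐 l f → 𝓐 l g → (∀ i → 𝓕 order f i ≡ 𝓕 order g i) → f ≋ g
  𝓐-ext f g f∈𝓐 g∈𝓐 eq =
    ≋-trans (≋-sym (𝓕⁻¹-𝓕 f f∈𝓐)) (≋-trans 𝓕⁻¹-cong (𝓕⁻¹-𝓕 g g∈𝓐))
    where
    𝓕⁻¹-cong : 𝓕⁻¹ order (𝓕 order f) ≋ 𝓕⁻¹ order (𝓕 order g)
    𝓕⁻¹-cong .at φ = trans (eval-linearCombination φ (𝓕 order f) _)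
      (trans (sum-cong-≗ λ i → cong (_* eval φ (x^ exponent order i)) (eq i))
             (sym (eval-linearCombination φ (𝓕 order g) _)))

-- The kernel of one operator on the image of another

Graded : ℤ → ℤ → (Polynomial → Polynomial) → Set
Graded l l′ T = ∀ f → 𝓐 l f → 𝓐 l′ (T f)

-- The selection `s` is built in so that the whole matrix (`s` the identity) and the chosen columns
-- are treated together.
𝓕-linear : ∀ {l l′} (order : MonomialOrder l) (order′ : MonomialOrder l′) {T} → Linear T →
  ∀ {n} (s : Fin n → Fin (dim l)) v i →
  𝓕 order′ (T (linearCombination polynomials v (λ j → x^ exponent order (s j)))) i
    ≡ (selectColumns (matrix order order′ T) s *ᵥ v) i
𝓕-linear order order′ {T} T-linear s v i = begin
  coeff (T (linearCombination polynomials v (λ j → x^ exponent order (s j)))) m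
    ≡⟨ ≋⇒≈ (linear-linearCombination T-linear v (λ j → x^ exponent order (s j))) m ⟩
  coeff (linearCombination polynomials v (λ j → T (x^ exponent order (s j)))) m
    ≡⟨ coeff-linearCombination m v (λ j → T (x^ exponent order (s j))) ⟩
  sum (λ j → v j * coeff (T (x^ exponent order (s j))) m)
    ≡⟨ sum-cong-≗ (λ j → ℚ.*-comm (v j) (coeff (T (x^ exponent order (s j))) m)) ⟩
  sum (λ j → coeff (T (x^ exponent order (s j))) m * v j) ∎
  where m = exponent order′ i

-- Common form of both parts: `T` is the Laplacian and `P` an averaging operator, known only through
-- its values lying in `Image` and exhausting the degree `l` part of `Image`.
module KernelOnImage
  {l l′} (order : MonomialOrder l) (order′ : MonomialOrder l′)
  {T P} (T-linear : Linear T) (T-graded : Graded l l′ T)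
  (P-linear : Linear P) (P-graded : Graded l l P)
  (Image : Polynomial → Set)
  (Image-resp-≋ : ∀ {f g} → f ≋ g → Image f → Image g)
  (P-Image : ∀ f → Image (P f))
  (P-surjective : ∀ f → 𝓐 l f → Image f → ∃[ g ] 𝓐 l g × P g ≋ f)
  where

  private
    D = matrix order order′ T
    A = matrix order order P

  𝓕-P : ∀ f → 𝓐 l f → ∀ i → 𝓕 order (P f) i ≡ (A *ᵥ 𝓕 order f) i
  𝓕-P f f∈𝓐 i = trans
    (sym (≋⇒≈ (resp-≋ P-linear (𝓕⁻¹-𝓕 order f f∈𝓐)) (exponent order i)))
    (𝓕-linear order order P-linear (λ j → j) (𝓕 order f) i)

  𝓕-T : ∀ f → 𝓐 l f → ∀ i → 𝓕 order′ (T f) i ≡ (D *ᵥ 𝓕 order f) i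
  𝓕-T f f∈𝓐 i = trans
    (sym (≋⇒≈ (resp-≋ T-linear (𝓕⁻¹-𝓕 order f f∈𝓐)) (exponent order′ i)))
    (𝓕-linear order order′ T-linear (λ j → j) (𝓕 order f) i)

  kernelOnImage-basis : ∀ {r} (s : Fin r → Fin (dim l)) →
    let B = selectColumns A s in
    IsBasis (ℚ^ dim l) (ColumnSpace A) (transpose B) →
    ∀ {t} (v : Fin t → Vector ℚ r) →
    IsBasis (ℚ^ r) (SolutionSpace (D *ₘ B)) v →
    IsBasis polynomials (λ f → (𝓐 l f × T f ≈ 0ₚ) × Image f) (λ i → 𝓕⁻¹ order (B *ᵥ v i))
  kernelOnImage-basis {r} s columns {t} v solutions = record
    { members     = members
    ; independent = independent
    ; spanning    = spanning
    }
    where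
    module Columns   = IsBasis columns
    module Solutions = IsBasis solutions
    B = selectColumns A s

    -- The chosen columns are the images under `P` of the chosen monomials, so `B *ᵥ z` is the
    -- coordinate vector of `P (preimage z)`; this places the candidate basis vectors in `Image`.
    preimage : Vector ℚ r → Polynomial
    preimage z = linearCombination polynomials z (λ j → x^ exponent order (s j))

    P-preimage : ∀ z → P (preimage z) ≋ 𝓕⁻¹ order (B *ᵥ z)
    P-preimage z = 𝓐-ext order (P (preimage z)) (𝓕⁻¹ order (B *ᵥ z))
      (P-graded (preimage z) preimage∈𝓐) (𝓐-𝓕⁻¹ order (B *ᵥ z))
      λ i → trans (𝓕-linear order order P-linear s z i) (sym (𝓕-𝓕⁻¹ order (B *ᵥ z) i))
      where
      preimage∈𝓐 : 𝓐 l (preimage z)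
      preimage∈𝓐 = 𝓐-linearCombination z _ λ j →
        subst (λ n → 𝓐 n (x^ exponent order (s j))) (exponent-degree order (s j)) (𝓐-x^ (exponent order (s j)))

    members : ∀ i → (𝓐 l (𝓕⁻¹ order (B *ᵥ v i)) × T (𝓕⁻¹ order (B *ᵥ v i)) ≈ 0ₚ) × Image (𝓕⁻¹ order (B *ᵥ v i))
    members i = (f∈𝓐 , ≋⇒≈ Tf≋0) , Image-resp-≋ (P-preimage (v i)) (P-Image (preimage (v i)))
      where
      f = 𝓕⁻¹ order (B *ᵥ v i)
      f∈𝓐 : 𝓐 l f
      f∈𝓐 = 𝓐-𝓕⁻¹ order (B *ᵥ v i)
      Tf≋0 : T f ≋ 0ₚ
      Tf≋0 = 𝓐-ext order′ (T f) 0ₚ (T-graded f f∈𝓐) 𝓐-0ₚ λ a → begin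
        𝓕 order′ (T f) a          ≡⟨ 𝓕-T f f∈𝓐 a ⟩
        (D *ᵥ 𝓕 order f) a        ≡⟨ *ᵥ-cong D (𝓕-𝓕⁻¹ order (B *ᵥ v i)) a ⟩
        (D *ᵥ (B *ᵥ v i)) a       ≡⟨ *ₘ-*ᵥ D B (v i) a ⟨
        ((D *ₘ B) *ᵥ v i) a       ≡⟨ Solutions.members i a ⟩
        0ℚ                        ∎

    𝓕-combination : ∀ c a → 𝓕 order (linearCombination polynomials c (λ i → 𝓕⁻¹ order (B *ᵥ v i))) a
                    ≡ (B *ᵥ linearCombination (ℚ^ r) c v) a
    𝓕-combination c a = begin
      coeff (linearCombination polynomials c (λ i → 𝓕⁻¹ order (B *ᵥ v i))) (exponent order a)
        ≡⟨ coeff-linearCombination (exponent order a) c _ ⟩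
      sum (λ i → c i * 𝓕 order (𝓕⁻¹ order (B *ᵥ v i)) a)
        ≡⟨ sum-cong-≗ (λ i → cong (c i *_) (𝓕-𝓕⁻¹ order (B *ᵥ v i) a)) ⟩
      sum (λ i → c i * (B *ᵥ v i) a)
        ≡⟨ *ᵥ-linearCombination B c v a ⟨
      (B *ᵥ linearCombination (ℚ^ r) c v) a ∎

    independent : ∀ c → linearCombination polynomials c (λ i → 𝓕⁻¹ order (B *ᵥ v i)) ≈ 0ₚ → ∀ i → c i ≡ 0ℚ
    -- Independence is used twice: that of the columns makes `B` injective, so the combination of
    -- the `v i` is zero; that of the `v i` then kills `c`.
    independent c ≈0 = Solutions.independent c (Columns.independent (linearCombination (ℚ^ r) c v) λ a → begin
      linearCombination (ℚ^ dim l) (linearCombination (ℚ^ r) c v) (transpose B) a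
        ≡⟨ *ᵥ-columns B (linearCombination (ℚ^ r) c v) a ⟨
      (B *ᵥ linearCombination (ℚ^ r) c v) a
        ≡⟨ 𝓕-combination c a ⟨
      𝓕 order (linearCombination polynomials c (λ i → 𝓕⁻¹ order (B *ᵥ v i))) a
        ≡⟨ ≈0 (exponent order a) ⟩
      0ℚ ∎)

    spanning : ∀ f → (𝓐 l f × T f ≈ 0ₚ) × Image f → Span polynomials (λ i → 𝓕⁻¹ order (B *ᵥ v i)) f
    spanning f ((f∈𝓐 , Tf≈0) , f∈Image) = c , ≋⇒≈ (𝓐-ext order f (linearCombination polynomials c fs) f∈𝓐
        (𝓐-linearCombination c fs λ i → 𝓐-𝓕⁻¹ order (B *ᵥ v i))
        λ a → begin
          𝓕 order f a                              ≡⟨ 𝓕f≡Bz a ⟩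
          (B *ᵥ z) a                               ≡⟨ *ᵥ-cong B z≡ a ⟩
          (B *ᵥ linearCombination (ℚ^ r) c v) a    ≡⟨ 𝓕-combination c a ⟨
          𝓕 order (linearCombination polynomials c fs) a ∎)
      where
      fs = λ i → 𝓕⁻¹ order (B *ᵥ v i)
      f∈columns : ColumnSpace A (𝓕 order f)
      -- Writing `f` as `P g` puts its coordinates into the column space, which yields `z`;
      -- `T f ≈ 0ₚ` then makes `z` a solution, hence a combination of the `v i`.
      f∈columns = let g , g∈𝓐 , Pg≋f = P-surjective f f∈𝓐 f∈Image in
        𝓕 order g , λ a → begin
          𝓕 order f a                                                ≡⟨ ≋⇒≈ Pg≋f (exponent order a) ⟨
          𝓕 order (P g) a                                            ≡⟨ 𝓕-P g g∈𝓐 a ⟩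
          (A *ᵥ 𝓕 order g) a                                         ≡⟨ *ᵥ-columns A (𝓕 order g) a ⟩
          linearCombination (ℚ^ dim l) (𝓕 order g) (transpose A) a   ∎
      z : Vector ℚ r
      z = proj₁ (Columns.spanning (𝓕 order f) f∈columns)
      𝓕f≡Bz : ∀ a → 𝓕 order f a ≡ (B *ᵥ z) a
      𝓕f≡Bz a = trans (proj₂ (Columns.spanning (𝓕 order f) f∈columns) a) (sym (*ᵥ-columns B z a))
      z-solution : SolutionSpace (D *ₘ B) z
      z-solution a = begin
        ((D *ₘ B) *ᵥ z) a      ≡⟨ *ₘ-*ᵥ D B z a ⟩
        (D *ᵥ (B *ᵥ z)) a      ≡⟨ *ᵥ-cong D 𝓕f≡Bz a ⟨
        (D *ᵥ 𝓕 order f) a     ≡⟨ 𝓕-T f f∈𝓐 a ⟨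
        𝓕 order′ (T f) a       ≡⟨ Tf≈0 (exponent order′ a) ⟩
        0ℚ                     ∎
      c : Vector ℚ t
      c = proj₁ (Solutions.spanning z z-solution)
      z≡ : ∀ j → z j ≡ linearCombination (ℚ^ r) c v j
      z≡ = proj₂ (Solutions.spanning z z-solution)

-- Orbit sums

orbitSum : List Mat₃ → Polynomial → Polynomial
orbitSum γs f = sumₚ (map (_∙ f) γs)

linear-orbitSum : ∀ γs → Linear (orbitSum γs)
linear-orbitSum []       = linear-0
linear-orbitSum (γ ∷ γs) = linear-+ₚ {γ ∙_} {orbitSum γs} (linear-∙ γ) (linear-orbitSum γs)

𝓐-orbitSum : ∀ {l} γs f → 𝓐 l f → 𝓐 l (orbitSum γs f)
𝓐-orbitSum []       f f∈𝓐 = 𝓐-0ₚ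
𝓐-orbitSum (γ ∷ γs) f f∈𝓐 = 𝓐-+ₚ (γ ∙ f) (orbitSum γs f) (𝓐-∙ γ f f∈𝓐) (𝓐-orbitSum γs f f∈𝓐)

+ₚ-cong : ∀ {f f′ g g′} → f ≋ f′ → g ≋ g′ → f +ₚ g ≋ f′ +ₚ g′
+ₚ-cong {f} {f′} {g} {g′} f≋f′ g≋g′ .at φ =
  trans (eval-+ₚ φ f g) (trans (cong₂ _+_ (f≋f′ .at φ) (g≋g′ .at φ)) (sym (eval-+ₚ φ f′ g′)))

·ₚ-cong : ∀ {f g} c → f ≋ g → c ·ₚ f ≋ c ·ₚ g
·ₚ-cong {f} {g} c f≋g .at φ =
  trans (eval-·ₚ φ c f) (trans (cong (c *_) (f≋g .at φ)) (sym (eval-·ₚ φ c g)))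

∙-orbitSum : ∀ γ γs f → γ ∙ orbitSum γs f ≋ orbitSum (map (γ ⊗_) γs) f
∙-orbitSum γ []        f = ≋-refl
∙-orbitSum γ (γ′ ∷ γs) f =
  ≋-trans (resp-+ₚ (linear-∙ γ) (γ′ ∙ f) (orbitSum γs f))
          (+ₚ-cong (∙-∙ γ γ′ f) (∙-orbitSum γ γs f))

-- Right translation of the list acts on the argument, whereas left translation acts on the result.
-- It turns the sum over Γγ₂ into an average over Γ.
orbitSum-∙ : ∀ γ γs f → orbitSum (map (_⊗ γ) γs) f ≋ orbitSum γs (γ ∙ f)
orbitSum-∙ γ []        f = ≋-refl
orbitSum-∙ γ (γ′ ∷ γs) f = +ₚ-cong (≋-sym (∙-∙ γ′ γ f)) (orbitSum-∙ γ γs f)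

orbitSum-↭ : ∀ {γs γs′} → γs ↭ γs′ → ∀ f → orbitSum γs f ≋ orbitSum γs′ f
orbitSum-↭ ↭.refl           f = ≋-refl
orbitSum-↭ (↭.prep γ p)     f = +ₚ-cong (≋-refl {γ ∙ f}) (orbitSum-↭ p f)
orbitSum-↭ (↭.trans p q)    f = ≋-trans (orbitSum-↭ p f) (orbitSum-↭ q f)
orbitSum-↭ (↭.swap {γs} {γs′} γ γ′ p) f .at φ = begin
  eval φ (γ ∙ f +ₚ (γ′ ∙ f +ₚ orbitSum γs f))
    ≡⟨ expand γ γ′ γs ⟩
  a + (b + eval φ (orbitSum γs f))
    ≡⟨ cong (λ x → a + (b + x)) (orbitSum-↭ p f .at φ) ⟩
  a + (b + eval φ (orbitSum γs′ f))
    ≡⟨ solve 3 (λ a b c → a :+ (b :+ c) := b :+ (a :+ c)) refl a b (eval φ (orbitSum γs′ f)) ⟩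
  b + (a + eval φ (orbitSum γs′ f))
    ≡⟨ expand γ′ γ γs′ ⟨
  eval φ (γ′ ∙ f +ₚ (γ ∙ f +ₚ orbitSum γs′ f)) ∎
  where
  open +-*-Solver
  a = eval φ (γ ∙ f)
  b = eval φ (γ′ ∙ f)
  expand : ∀ γ γ′ γs → eval φ (γ ∙ f +ₚ (γ′ ∙ f +ₚ orbitSum γs f))
                     ≡ eval φ (γ ∙ f) + (eval φ (γ′ ∙ f) + eval φ (orbitSum γs f))
  expand γ γ′ γs = trans (eval-+ₚ φ (γ ∙ f) (γ′ ∙ f +ₚ orbitSum γs f))
    (cong (λ x → eval φ (γ ∙ f) + x) (eval-+ₚ φ (γ′ ∙ f) (orbitSum γs f)))

orbitSum-fixed : ∀ γs f → (∀ {γ} → γ ∈ γs → γ ∙ f ≋ f) → orbitSum γs f ≋ (length γs ×ℚ 1ℚ) ·ₚ f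
orbitSum-fixed []       f fixed .at φ = sym (trans (eval-·ₚ φ 0ℚ f) (ℚ.*-zeroˡ (eval φ f)))
orbitSum-fixed (γ ∷ γs) f fixed .at φ = begin
  eval φ (γ ∙ f +ₚ orbitSum γs f)
    ≡⟨ eval-+ₚ φ (γ ∙ f) (orbitSum γs f) ⟩
  eval φ (γ ∙ f) + eval φ (orbitSum γs f)
    ≡⟨ cong₂ _+_ (fixed (here refl) .at φ) (trans (orbitSum-fixed γs f (fixed ∘ there) .at φ) (eval-·ₚ φ n f)) ⟩
  eval φ f + n * eval φ f
    ≡⟨ cong (_+ n * eval φ f) (ℚ.*-identityˡ (eval φ f)) ⟨
  1ℚ * eval φ f + n * eval φ f
    ≡⟨ ℚ.*-distribʳ-+ (eval φ f) 1ℚ n ⟨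
  (1ℚ + n) * eval φ f
    ≡⟨ eval-·ₚ φ (1ℚ + n) f ⟨
  eval φ ((1ℚ + n) ·ₚ f) ∎
  where n = length γs ×ℚ 1ℚ

-- The group Γ ∪ Γγ₂

-- A criterion for `_↭_` between duplicate-free lists that can be decided by evaluation on explicit
-- matrices.
Rearrangement : {A : Set} → List A → List A → Set
Rearrangement xs ys = Unique xs × Unique ys × All (_∈ ys) xs × All (_∈ xs) ys

rearrangement⇒↭ : {A : Set} {xs ys : List A} → Rearrangement xs ys → xs ↭ ys
rearrangement⇒↭ (xs! , ys! , xs⊆ys , ys⊆xs) =
  ∼bag⇒↭ (unique∧set⇒bag xs! ys! (mk⇔ (All.lookup xs⊆ys) (All.lookup ys⊆xs)))

_≟ₘ_ : DecidableEquality Mat₃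
_≟ₘ_ = Vec.≡-dec (Vec.≡-dec ℚ._≟_)

rearrangement? : (xs ys : List Mat₃) → Dec (Rearrangement xs ys)
rearrangement? xs ys =
  unique? xs ×-dec unique? ys ×-dec all? (_∈? ys) xs ×-dec all? (_∈? xs) ys
  where
  open DecMembership _≟ₘ_ using (_∈?_)
  open DecUnique _≟ₘ_ using (unique?)

Γ-list : List Mat₃
Γ-list = Enumeration.elements Γ-enumeration

-- Unfolding order-Γ unfolds the list of elements of Γ, whose name is private to Defs.
opaque
  unfolding ℱ order-Γ

  -- `γ₂` normalises Γ, because `𝐢-𝐣` normalises the unit group of the Hurwitz order.
  γ₂⊗Γ : Rearrangement (map (γ₂ ⊗_) Γ-list) (map (_⊗ γ₂) Γ-list)
  γ₂⊗Γ = from-yes (rearrangement? (map (γ₂ ⊗_) Γ-list) (map (_⊗ γ₂) Γ-list))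

  γ₂⊗Γγ₂ : Rearrangement (map (γ₂ ⊗_) (map (_⊗ γ₂) Γ-list)) Γ-list
  γ₂⊗Γγ₂ = from-yes (rearrangement? (map (γ₂ ⊗_) (map (_⊗ γ₂) Γ-list)) Γ-list)

  γ⊗Γ : All (λ γ → Rearrangement (map (γ ⊗_) Γ-list) Γ-list) Γ-list
  γ⊗Γ = from-yes (all? (λ γ → rearrangement? (map (γ ⊗_) Γ-list) Γ-list) Γ-list)

  -- The square of `𝐢-𝐣` is the central element -2, so conjugation by it is an involution.
  inverse-γ₂ : inverse γ₂ ≡ γ₂
  inverse-γ₂ = refl

Γ-invariant : Polynomial → Set
Γ-invariant f = ∀ γ → Γ γ → γ ∙ f ≈ f

Γ-invariant-resp-≋ : ∀ {f g} → f ≋ g → Γ-invariant f → Γ-invariant g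
Γ-invariant-resp-≋ f≋g invariant γ Γγ =
  ≋⇒≈ (≋-trans (resp-≋ (linear-∙ γ) (≋-sym f≋g)) (≋-trans (≈⇒≋ (invariant γ Γγ)) f≋g))

Ave-invariant : ∀ f → Γ-invariant (Ave f)
Ave-invariant f γ Γγ = ≋⇒≈ (≋-trans (∙-orbitSum γ Γ-list f)
  (orbitSum-↭ (rearrangement⇒↭ (All.lookup γ⊗Γ (Enumeration.complete Γ-enumeration Γγ))) f))

Ave-of-invariant : ∀ f → Γ-invariant f → Ave f ≋ fromℤ (+ 12) ·ₚ f
Ave-of-invariant f invariant = subst (λ n → Ave f ≋ (n ×ℚ 1ℚ) ·ₚ f) order-Γ
  (orbitSum-fixed Γ-list f λ {γ} γ∈ → ≈⇒≋ (invariant γ (Enumeration.sound Γ-enumeration γ∈)))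

linear-Ave : Linear Ave
linear-Ave = linear-orbitSum Γ-list

linear-Ave± : ∀ σ l → Linear (Ave± σ l)
linear-Ave± σ l = linear-+ₚ {Ave} linear-Ave
  (linear-·ₚ (signed σ l) (linear-orbitSum (Enumeration.elements Γγ₂-enumeration)))

𝓐-Ave± : ∀ σ l → Graded (+ l) (+ l) (Ave± σ l)
𝓐-Ave± σ l f f∈𝓐 = 𝓐-+ₚ (Ave f) (signed σ l ·ₚ orbitSum γs f) (𝓐-orbitSum Γ-list f f∈𝓐)
  (𝓐-·ₚ (signed σ l) (orbitSum γs f) (𝓐-orbitSum γs f f∈𝓐))
  where γs = Enumeration.elements Γγ₂-enumeration

rescale : ∀ {T} → Linear T → ∀ {l} c d → d * c ≡ 1ℚ → ∀ f → 𝓐 l f → T f ≋ c ·ₚ f →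
          ∃[ g ] 𝓐 l g × T g ≋ f
rescale {T} T-linear c d dc≡1 f f∈𝓐 Tf≋cf =
  d ·ₚ f , 𝓐-·ₚ d f f∈𝓐 , ≋-trans (resp-·ₚ T-linear d f) (≋-trans (·ₚ-cong d Tf≋cf) cancel)
  where
  cancel : d ·ₚ (c ·ₚ f) ≋ f
  cancel .at φ = begin
    eval φ (d ·ₚ (c ·ₚ f))   ≡⟨ trans (eval-·ₚ φ d (c ·ₚ f)) (cong (d *_) (eval-·ₚ φ c f)) ⟩
    d * (c * eval φ f)       ≡⟨ ℚ.*-assoc d c (eval φ f) ⟨
    d * c * eval φ f         ≡⟨ cong (_* eval φ f) dc≡1 ⟩
    1ℚ * eval φ f            ≡⟨ ℚ.*-identityˡ (eval φ f) ⟩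
    eval φ f                 ∎

-- The operator `T₂` and its eigenspaces

signed² : ∀ σ l → signed σ l * signed σ l ≡ 1ℚ
signed² σ l = trans (square σ) ([-1]² l)
  where
  neg² : ∀ p → - p * - p ≡ p * p
  neg² p = solve 1 (λ p → :- p :* :- p := p :* p) refl p
    where open +-*-Solver
  square : ∀ σ → signed σ l * signed σ l ≡ [-1]^ l * [-1]^ l
  square Sign.+ = refl
  square Sign.- = neg² ([-1]^ l)
  [-1]² : ∀ l → [-1]^ l * [-1]^ l ≡ 1ℚ
  [-1]² zero    = refl
  [-1]² (suc l) = trans (neg² ([-1]^ l)) ([-1]² l)

-- The sum has one term, as `γ₂` represents the only coset, and `γ₂` is its own inverse.
T₂≋γ₂∙ : ∀ f → T₂ f ≋ γ₂ ∙ f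
T₂≋γ₂∙ f .at φ =
  trans (eval-+ₚ φ (inverse γ₂ ∙ f) 0ₚ)
    (trans (ℚ.+-identityʳ (eval φ (inverse γ₂ ∙ f))) (cong (λ γ → eval φ (γ ∙ f)) inverse-γ₂))

-- Reduces the Γ-invariance of the signed average, and its scalar on eigenvectors, to the
-- corresponding facts about `Ave`.
Ave±≋Ave : ∀ σ l f → Ave± σ l f ≋ Ave (f +ₚ signed σ l ·ₚ (γ₂ ∙ f))
Ave±≋Ave σ l f = ≋-sym (≋-trans (resp-+ₚ linear-Ave f (ε ·ₚ (γ₂ ∙ f)))
  (+ₚ-cong (≋-refl {Ave f}) (≋-trans (resp-·ₚ linear-Ave ε (γ₂ ∙ f))
    (·ₚ-cong ε (≋-sym (orbitSum-∙ γ₂ Γ-list f))))))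
  where ε = signed σ l

T₂-eigen : Sign → ℕ → Polynomial → Set
T₂-eigen σ l f = Γ-invariant f × T₂ f ≈ signed σ l ·ₚ f

T₂-eigen-resp-≋ : ∀ σ l {f g} → f ≋ g → T₂-eigen σ l f → T₂-eigen σ l g
T₂-eigen-resp-≋ σ l {f} {g} f≋g (invariant , T₂f) = Γ-invariant-resp-≋ f≋g invariant ,
  ≋⇒≈ (≋-trans (T₂≋γ₂∙ g) (≋-trans (resp-≋ (linear-∙ γ₂) (≋-sym f≋g))
    (≋-trans (≋-sym (T₂≋γ₂∙ f)) (≋-trans (≈⇒≋ T₂f) (·ₚ-cong (signed σ l) f≋g)))))

Ave±-eigen : ∀ σ l f → T₂-eigen σ l (Ave± σ l f)
Ave±-eigen σ l f =
  Γ-invariant-resp-≋ (≋-sym (Ave±≋Ave σ l f)) (Ave-invariant (f +ₚ ε ·ₚ (γ₂ ∙ f))) ,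
  ≋⇒≈ (≋-trans (T₂≋γ₂∙ (Ave± σ l f)) swapped)
  where
  ε = signed σ l
  Γγ₂-list = Enumeration.elements Γγ₂-enumeration
  a a′ : Polynomial
  a  = orbitSum Γ-list f
  a′ = orbitSum Γγ₂-list f
  γ₂∙a : γ₂ ∙ a ≋ a′
  γ₂∙a = ≋-trans (∙-orbitSum γ₂ Γ-list f) (orbitSum-↭ (rearrangement⇒↭ γ₂⊗Γ) f)
  γ₂∙a′ : γ₂ ∙ a′ ≋ a
  γ₂∙a′ = ≋-trans (∙-orbitSum γ₂ Γγ₂-list f) (orbitSum-↭ (rearrangement⇒↭ γ₂⊗Γγ₂) f)
  -- `γ₂` exchanges the sums over Γ and Γγ₂; since `ε * ε` is one, the exchange amounts to
  -- multiplication by `ε`.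
  swapped : γ₂ ∙ (a +ₚ ε ·ₚ a′) ≋ ε ·ₚ (a +ₚ ε ·ₚ a′)
  swapped .at φ = begin
    eval φ (γ₂ ∙ (a +ₚ ε ·ₚ a′))
      ≡⟨ ≋-trans (resp-+ₚ (linear-∙ γ₂) a (ε ·ₚ a′))
           (+ₚ-cong γ₂∙a (≋-trans (resp-·ₚ (linear-∙ γ₂) ε a′) (·ₚ-cong ε γ₂∙a′))) .at φ ⟩
    eval φ (a′ +ₚ ε ·ₚ a)
      ≡⟨ expand a′ a ⟩
    x′ + ε * x
      ≡⟨ cong (_+ ε * x) (trans (sym (ℚ.*-identityˡ x′)) (cong (_* x′) (sym (signed² σ l)))) ⟩
    ε * ε * x′ + ε * x
      ≡⟨ solve 3 (λ ε x x′ → ε :* ε :* x′ :+ ε :* x := ε :* (x :+ ε :* x′)) refl ε x x′ ⟩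
    ε * (x + ε * x′)
      ≡⟨ trans (eval-·ₚ φ ε (a +ₚ ε ·ₚ a′)) (cong (ε *_) (expand a a′)) ⟨
    eval φ (ε ·ₚ (a +ₚ ε ·ₚ a′)) ∎
    where
    open +-*-Solver
    x x′ : ℚ
    x  = eval φ a
    x′ = eval φ a′
    expand : ∀ f g → eval φ (f +ₚ ε ·ₚ g) ≡ eval φ f + ε * eval φ g
    expand f g = trans (eval-+ₚ φ f (ε ·ₚ g)) (cong (λ y → eval φ f + y) (eval-·ₚ φ ε g))

-- On an eigenvector `γ₂` gives a second factor `ε` that cancels the first, so `f` is doubled before
-- averaging multiplies it by 12.
Ave±-of-eigen : ∀ σ l f → T₂-eigen σ l f → Ave± σ l f ≋ fromℤ (+ 24) ·ₚ f
Ave±-of-eigen σ l f (invariant , T₂f) .at φ = begin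
  eval φ (Ave± σ l f)
    ≡⟨ ≋-trans (Ave±≋Ave σ l f) (resp-≋ linear-Ave doubled) .at φ ⟩
  eval φ (Ave (fromℤ (+ 2) ·ₚ f))
    ≡⟨ ≋-trans (resp-·ₚ linear-Ave (fromℤ (+ 2)) f) (·ₚ-cong (fromℤ (+ 2)) (Ave-of-invariant f invariant)) .at φ ⟩
  eval φ (fromℤ (+ 2) ·ₚ (fromℤ (+ 12) ·ₚ f))
    ≡⟨ trans (eval-·ₚ φ (fromℤ (+ 2)) (fromℤ (+ 12) ·ₚ f)) (cong (fromℤ (+ 2) *_) (eval-·ₚ φ (fromℤ (+ 12)) f)) ⟩
  fromℤ (+ 2) * (fromℤ (+ 12) * eval φ f)
    ≡⟨ ℚ.*-assoc (fromℤ (+ 2)) (fromℤ (+ 12)) (eval φ f) ⟨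
  fromℤ (+ 24) * eval φ f
    ≡⟨ eval-·ₚ φ (fromℤ (+ 24)) f ⟨
  eval φ (fromℤ (+ 24) ·ₚ f) ∎
  where
  ε = signed σ l
  γ₂∙f : γ₂ ∙ f ≋ ε ·ₚ f
  γ₂∙f = ≋-trans (≋-sym (T₂≋γ₂∙ f)) (≈⇒≋ T₂f)
  doubled : f +ₚ ε ·ₚ (γ₂ ∙ f) ≋ fromℤ (+ 2) ·ₚ f
  doubled .at φ = begin
    eval φ (f +ₚ ε ·ₚ (γ₂ ∙ f))           ≡⟨ eval-+ₚ φ f (ε ·ₚ (γ₂ ∙ f)) ⟩
    eval φ f + eval φ (ε ·ₚ (γ₂ ∙ f))     ≡⟨ cong (λ y → eval φ f + y) (·ₚ-cong ε γ₂∙f .at φ) ⟩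
    eval φ f + eval φ (ε ·ₚ (ε ·ₚ f))
      ≡⟨ cong (λ y → eval φ f + y) (trans (eval-·ₚ φ ε (ε ·ₚ f)) (cong (ε *_) (eval-·ₚ φ ε f))) ⟩
    eval φ f + ε * (ε * eval φ f)
      ≡⟨ cong (λ y → eval φ f + y)
           (trans (sym (ℚ.*-assoc ε ε (eval φ f))) (cong (_* eval φ f) (signed² σ l))) ⟩
    eval φ f + 1ℚ * eval φ f
      ≡⟨ solve 1 (λ x → x :+ con 1ℚ :* x := con (fromℤ (+ 2)) :* x) refl (eval φ f) ⟩
    fromℤ (+ 2) * eval φ f                ≡⟨ eval-·ₚ φ (fromℤ (+ 2)) f ⟨
    eval φ (fromℤ (+ 2) ·ₚ f)             ∎
    where open +-*-Solver

mainTheorem4 : (order : ∀ k → MonomialOrder k) (l : ℕ) →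
    let d = dim (+ l)
        D = matrix (order (+ l)) (order (+ l - + 2)) Δ-Q
        A = matrix (order (+ l)) (order (+ l)) Ave
        A± = λ (σ : Sign) → matrix (order (+ l)) (order (+ l)) (Ave± σ l)
    in
    (∀ {r} (s : Fin r → Fin d) →
      let B = selectColumns A s in
      IsBasis (ℚ^ d) (ColumnSpace A) (transpose B) →
      ∀ {t} (v : Fin t → Vector ℚ r) →
      IsBasis (ℚ^ r) (SolutionSpace (D *ₘ B)) v →
      IsBasis polynomials (𝓗^Γ l) (λ i → 𝓕⁻¹ (order (+ l)) (B *ᵥ v i)))
    ×
    (∀ (σ : Sign) {r} (s : Fin r → Fin d) →
      let B = selectColumns (A± σ) s in
      IsBasis (ℚ^ d) (ColumnSpace (A± σ)) (transpose B) →
      ∀ {t} (v : Fin t → Vector ℚ r) →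
      IsBasis (ℚ^ r) (SolutionSpace (D *ₘ B)) v →
      IsBasis polynomials (𝓗^Γ± σ l) (λ i → 𝓕⁻¹ (order (+ l)) (B *ᵥ v i)))
mainTheorem4 order l =
  -- With `Γ-invariant` as image, the predicate of the general result unfolds to `𝓗^Γ l`.
  Invariants.kernelOnImage-basis ,
  λ σ s columns v solutions →
    let module Basis = IsBasis (Eigenspaces.kernelOnImage-basis σ s columns v solutions) in record
    -- `𝓗^Γ±` groups invariance with harmonicity, `T₂-eigen` groups it with the eigenvalue equation;
    -- only the bracketing changes.
    { members     = λ i → let ((𝓗f , invariant , T₂f)) = Basis.members i in (𝓗f , invariant) , T₂f
    ; independent = Basis.independent
    ; spanning    = λ f ((𝓗f , invariant) , T₂f) → Basis.spanning f (𝓗f , invariant , T₂f)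
    }
  where
  Ave-surjective : ∀ f → 𝓐 (+ l) f → Γ-invariant f → ∃[ g ] 𝓐 (+ l) g × Ave g ≋ f
  Ave-surjective f f∈𝓐 invariant =
    rescale linear-Ave (fromℤ (+ 12)) (+ 1 / 12) refl f f∈𝓐 (Ave-of-invariant f invariant)

  Ave±-surjective : ∀ σ f → 𝓐 (+ l) f → T₂-eigen σ l f → ∃[ g ] 𝓐 (+ l) g × Ave± σ l g ≋ f
  Ave±-surjective σ f f∈𝓐 eigen =
    rescale (linear-Ave± σ l) (fromℤ (+ 24)) (+ 1 / 24) refl f f∈𝓐 (Ave±-of-eigen σ l f eigen)

  module Invariants = KernelOnImage (order (+ l)) (order (+ l - + 2)) linear-Δ-Q 𝓐-Δ-Q
    linear-Ave (𝓐-orbitSum Γ-list) Γ-invariant Γ-invariant-resp-≋ Ave-invariant Ave-surjective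

  module Eigenspaces σ = KernelOnImage (order (+ l)) (order (+ l - + 2)) linear-Δ-Q 𝓐-Δ-Q
    (linear-Ave± σ l) (𝓐-Ave± σ l) (T₂-eigen σ l) (T₂-eigen-resp-≋ σ l) (Ave±-eigen σ l) (Ave±-surjective σ)
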